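{- There is a satisfiable $\Pi_2$ sentence $\varphi$ of $\mathcal{L}_{\omega_1\omega}$ in the language of trees, extending the axioms of trees (every model of $\varphi$ is a tree), such that no model of $\varphi$ has a $\Sigma_3$ Scott sentence, and hence every model of $\varphi$ has Scott rank at least $2$.
   Context: All structures (in particular all models considered) are countable. A tree is a rooted connected acyclic graph, viewed as a structure in the language $\mathcal{L}_{tree} = \{r, P\}$, where $r$ is a constant for the root and $P$ is the parent relation, holding between each non-root vertex and its parent (the language is formally treated as relational, so $P$ is a binary relation). $\mathcal{L}_{\omega_1\omega}$ is the infinitary logic allowing countable conjunctions and disjunctions. The hierarchy $\Sigma_\alpha/\Pi_\alpha$ of $\mathcal{L}_{\omega_1\omega}$ formulas is the usual one: $\Sigma_0=\Pi_0$ are the finitary quantifier-free formulas; for $\alpha>0$, a $\Sigma_\alpha$ formula is a countable disjunction of formulas $\exists \bar y\,\psi$ with $\psi$ a $\Pi_\beta$ formula for some $\beta<\alpha$, and a $\Pi_\alpha$ formula is a countable conjunction of formulas $\forall \bar y\,\psi$ with $\psi$ a $\Sigma_\beta$ formula for some $\beta<\alpha$. A Scott sentence for a countable structure $\mathcal{A}$ is an $\mathcal{L}_{\omega_1\omega}$ sentence $\theta$ such that for all countable structures $\mathcal{B}$ in the same language, $\mathcal{B}\models\theta$ if and only if $\mathcal{B}\cong\mathcal{A}$. The Scott rank of $\mathcal{A}$ is the least $\alpha$ such that $\mathcal{A}$ has a $\Pi_{\alpha+1}$ Scott sentence. -}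

module Defs where

open import Level using (0ℓ)
open import Data.Nat using (ℕ; zero; suc; _+_)
import Data.Nat as ℕ
open import Data.Fin using (Fin)
open import Data.List using (List; _∷_; head; last; length)
open import Data.List.Relation.Unary.Linked using (Linked)
open import Data.List.Relation.Unary.Unique.Propositional using (Unique)
open import Data.Maybe using (just)
open import Data.Product using (∃; ∃-syntax; _×_; _,_)
open import Data.Sum using (_⊎_)
open import Data.Empty using (⊥)
open import Data.Unit using (⊤)
open import Data.Vec using (Vec; []; _∷_; lookup)
open import Function.Bundles using (_⇔_; mk⇔; _↔_; _↣_; Inverse)
open import Relation.Binary.Core using (Rel)
open import Relation.Binary.Definitions using (Symmetric; Irreflexive)
open import Relation.Binary.PropositionalEquality using (_≡_)
open import Relation.Nullary using (¬_)

------------------------------------------------------------------------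
-- Countable ordinals

-- Brouwer notations: lim f denotes the supremum of an arbitrary sequence f,
-- so every countable ordinal has a notation, but not a unique one.  Ordinals
-- are compared with _≤ₒ_ only, never with _≡_.

data Ord : Set where
  zero : Ord
  suc  : Ord → Ord
  lim  : (ℕ → Ord) → Ord

infix 4 _≤ₒ_ _<ₒ_

data _≤ₒ_ : Ord → Ord → Set where
  z≤   : ∀ {α} → zero ≤ₒ α
  s≤s  : ∀ {α β} → α ≤ₒ β → suc α ≤ₒ suc β
  ≤lim : ∀ {α f} n → α ≤ₒ f n → α ≤ₒ lim f
  lim≤ : ∀ {f β} → (∀ n → f n ≤ₒ β) → lim f ≤ₒ β

_<ₒ_ : Ord → Ord → Set
α <ₒ β = suc α ≤ₒ β

≤ₒ-trans : ∀ {α β γ} → α ≤ₒ β → β ≤ₒ γ → α ≤ₒ γ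
≤ₒ-trans z≤         q          = z≤
≤ₒ-trans (lim≤ p)   q          = lim≤ λ n → ≤ₒ-trans (p n) q
≤ₒ-trans (s≤s p)    (s≤s q)    = s≤s (≤ₒ-trans p q)
≤ₒ-trans (s≤s p)    (≤lim n q) = ≤lim n (≤ₒ-trans (s≤s p) q)
≤ₒ-trans (≤lim n p) (≤lim m q) = ≤lim m (≤ₒ-trans (≤lim n p) q)
≤ₒ-trans (≤lim n p) (lim≤ q)   = ≤ₒ-trans p (q n)

fin : ℕ → Ord
fin zero    = zero
fin (suc n) = suc (fin n)

------------------------------------------------------------------------
-- Countable structures in the language {r, P}

-- An injection into ℕ makes a structure finite or countably infinite.
-- In a tree, P x y says that y is the parent of x.

record Structure : Set₁ where
  field
    Carrier   : Set
    countable : Carrier ↣ ℕ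
    r         : Carrier
    P         : Rel Carrier 0ℓ

open Structure

record _≅_ (A B : Structure) : Set where
  field
    bijection : Carrier A ↔ Carrier B

  open Inverse bijection public using (to)

  field
    r-preserved : to (r A) ≡ r B
    P-preserved : ∀ x y → P A x y ⇔ P B (to x) (to y)

------------------------------------------------------------------------
-- Trees

module _ {V : Set} (E : Rel V 0ℓ) where

  -- A path is the list of the pairwise distinct vertices it visits; its
  -- number of edges is one less than the length of the list.
  record Path (x : V) (xs : List V) (y : V) : Set where
    field
      starts   : head xs ≡ just x
      ends     : last xs ≡ just y
      linked   : Linked E xs
      distinct : Unique xs

  Connected : Set
  Connected = ∀ x y → ∃[ xs ] Path x xs y

  -- A cycle is a path on at least three vertices whose endpoints are adjacent.
  Acyclic : Set
  Acyclic = ∀ {x xs y} → Path x xs y → 3 ℕ.≤ length xs → ¬ E y x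

  -- With respect to the root ρ, the parent of x is the vertex after x on a
  -- path from x to ρ; the root has no parent.
  IsParent : V → V → V → Set
  IsParent ρ x y = ∃[ xs ] Path x (x ∷ y ∷ xs) ρ

record IsTree (A : Structure) : Set₁ where
  field
    E           : Rel (Carrier A) 0ℓ
    symmetric   : Symmetric E
    irreflexive : Irreflexive _≡_ E
    connected   : Connected E
    acyclic     : Acyclic E
    parent      : ∀ x y → P A x y ⇔ IsParent E (r A) x y

------------------------------------------------------------------------
-- The infinitary logic

-- Formula n has its free variables among n de Bruijn variables, and the
-- quantifiers bind variable zero.  Countable conjunctions and disjunctions
-- are indexed by ℕ: a finite one repeats a member, and an empty one is
-- obtained by repeating ⊤ᶠ or ⊥ᶠ.

data Term (n : ℕ) : Set where
  var  : Fin n → Term n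
  root : Term n

infix  8 _≐_
infixr 7 _∧ᶠ_
infixr 6 _∨ᶠ_

data Formula (n : ℕ) : Set where
  _≐_       : Term n → Term n → Formula n
  Pᶠ        : Term n → Term n → Formula n
  ⊤ᶠ ⊥ᶠ     : Formula n
  ¬ᶠ_       : Formula n → Formula n
  _∧ᶠ_ _∨ᶠ_ : Formula n → Formula n → Formula n
  ⋀ ⋁       : (ℕ → Formula n) → Formula n
  ∀ᶠ ∃ᶠ     : Formula (suc n) → Formula n

Sentence : Set
Sentence = Formula 0

∀* ∃* : ∀ {n} k → Formula (k + n) → Formula n
∀* zero    φ = φ
∀* (suc k) φ = ∀* k (∀ᶠ φ)
∃* zero    φ = φ
∃* (suc k) φ = ∃* k (∃ᶠ φ)

module _ (A : Structure) where

  ⟦_⟧ : ∀ {n} → Term n → Vec (Carrier A) n → Carrier A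
  ⟦ var i ⟧ v = lookup v i
  ⟦ root  ⟧ v = r A

  Sat : ∀ {n} → Formula n → Vec (Carrier A) n → Set
  Sat (s ≐ t)  v = ⟦ s ⟧ v ≡ ⟦ t ⟧ v
  Sat (Pᶠ s t) v = P A (⟦ s ⟧ v) (⟦ t ⟧ v)
  Sat ⊤ᶠ       v = ⊤
  Sat ⊥ᶠ       v = ⊥
  Sat (¬ᶠ φ)   v = ¬ Sat φ v
  Sat (φ ∧ᶠ ψ) v = Sat φ v × Sat ψ v
  Sat (φ ∨ᶠ ψ) v = Sat φ v ⊎ Sat ψ v
  Sat (⋀ φ)    v = ∀ i → Sat (φ i) v
  Sat (⋁ φ)    v = ∃[ i ] Sat (φ i) v
  Sat (∀ᶠ φ)   v = ∀ x → Sat φ (x ∷ v)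
  Sat (∃ᶠ φ)   v = ∃[ x ] Sat φ (x ∷ v)

infix 4 _⊨_

_⊨_ : Structure → Sentence → Set
A ⊨ φ = Sat A φ []

data QuantifierFree {n : ℕ} : Formula n → Set where
  _≐_  : ∀ s t → QuantifierFree (s ≐ t)
  Pᶠ   : ∀ s t → QuantifierFree (Pᶠ s t)
  ⊤ᶠ   : QuantifierFree ⊤ᶠ
  ⊥ᶠ   : QuantifierFree ⊥ᶠ
  ¬ᶠ_  : ∀ {φ} → QuantifierFree φ → QuantifierFree (¬ᶠ φ)
  _∧ᶠ_ : ∀ {φ ψ} → QuantifierFree φ → QuantifierFree ψ → QuantifierFree (φ ∧ᶠ ψ)
  _∨ᶠ_ : ∀ {φ ψ} → QuantifierFree φ → QuantifierFree ψ → QuantifierFree (φ ∨ᶠ ψ)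

-- The condition α ≤ₒ zero allows for all notations of the ordinal 0.  In the
-- other clauses α > 0 holds automatically, because some β <ₒ α is given.

mutual

  data IsΣ (α : Ord) {n : ℕ} : Formula n → Set where
    qf : ∀ {φ} → α ≤ₒ zero → QuantifierFree φ → IsΣ α φ
    ⋁∃ : ∀ {φ} → (∀ i → Is∃Π α (φ i)) → IsΣ α (⋁ φ)

  data Is∃Π (α : Ord) {n : ℕ} : Formula n → Set where
    block : ∀ {β} → β <ₒ α → ∀ k {ψ} → IsΠ β ψ → Is∃Π α (∃* k ψ)

  data IsΠ (α : Ord) {n : ℕ} : Formula n → Set where
    qf : ∀ {φ} → α ≤ₒ zero → QuantifierFree φ → IsΠ α φ
    ⋀∀ : ∀ {φ} → (∀ i → Is∀Σ α (φ i)) → IsΠ α (⋀ φ)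

  data Is∀Σ (α : Ord) {n : ℕ} : Formula n → Set where
    block : ∀ {β} → β <ₒ α → ∀ k {ψ} → IsΣ β ψ → Is∀Σ α (∀* k ψ)

------------------------------------------------------------------------
-- Scott sentences and Scott rank

IsScottSentence : Sentence → Structure → Set₁
IsScottSentence θ A = ∀ B → (B ⊨ θ) ⇔ (B ≅ A)

HasΣScottSentence : Ord → Structure → Set₁
HasΣScottSentence α A = ∃[ θ ] IsΣ α θ × IsScottSentence θ A

HasΠScottSentence : Ord → Structure → Set₁
HasΠScottSentence α A = ∃[ θ ] IsΠ α θ × IsScottSentence θ A

record IsScottRank (A : Structure) (α : Ord) : Set₁ where
  field
    attained : HasΠScottSentence (suc α) A
    least    : ∀ β → HasΠScottSentence (suc β) A → α ≤ₒ β

-- The Scott rank is the minimum of the α for which A has a Π (suc α) Scott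
-- sentence.  It is at least β iff β is a lower bound of these α.  Unlike
-- "every α with IsScottRank A α satisfies β ≤ₒ α", this has content without
-- knowing that the minimum exists; the two agree by scottRank≥⇔.

ScottRank≥ : Ord → Structure → Set₁
ScottRank≥ β A = ∀ α → HasΠScottSentence (suc α) A → β ≤ₒ α

scottRank≥⇔ : ∀ {A α β} → IsScottRank A α → ScottRank≥ β A ⇔ β ≤ₒ α
scottRank≥⇔ {α = α} R = mk⇔
  (λ lb → lb α attained)
  (λ β≤α γ h → ≤ₒ-trans β≤α (least γ h))
  where open IsScottRank R

{-# OPTIONS --safe #-}

-- Code a sequence g of elements of 2 × 2 by a ladder: a top with two nodes on every level below
-- it, where g i lists the parents of the two nodes on level i + 1 among those on level i.
-- Finitely many nodes decide a finite part of the sequence positively, so a Π₂ sentence can say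
-- that the structure is a tree whose root carries ladders, and that their sequences are dense.
-- In a model A no ladder is isolated by a Σ₁ formula.  Given a Π₂ formula ψ(a) true in A, extend A
-- by a ladder for a sequence c that is generic for A.  No ladder of A carries c, so the extension
-- B is not isomorphic to A, but B still satisfies ψ(a), because every finite part of the new
-- ladder is imitated by ladders of A that avoid any given finite set.  Hence no Σ₃ sentence that
-- is true in A determines A.
module Submission where

open import Defs
open import Level using (0ℓ; lift; lower) renaming (suc to lsuc)
open import Axiom.ExcludedMiddle using (ExcludedMiddle)
open import Data.Bool using (Bool; true; false)
open import Data.Empty using (⊥; ⊥-elim)
open import Data.Fin using (Fin; zero; suc; toℕ; splitAt; _↑ˡ_; _↑ʳ_)
open import Data.Fin.Patterns using (0F; 1F; 2F; 3F)
open import Data.List using (List; []; _∷_; last; length)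
open import Data.List.Membership.Propositional using (_∈_)
open import Data.List.Relation.Unary.All using (All; []; _∷_)
import Data.List.Relation.Unary.All as All
import Data.List.Relation.Unary.All.Properties as All
open import Data.List.Relation.Unary.AllPairs using ([]; _∷_)
open import Data.List.Relation.Unary.Any using (here; there)
open import Data.List.Relation.Unary.Linked using (Linked; [-]; _∷_)
open import Data.List.Relation.Unary.Unique.Propositional using (Unique)
open import Data.Maybe using (just)
open import Data.Nat using (ℕ; zero; suc; _+_; _∸_; _⊔_; _≤_; _<_; z≤n; s≤s; _≤?_; _≟_)
open import Data.Nat.Properties
open import Data.Product using (∃; ∃-syntax; _×_; _,_; proj₁; proj₂)
open import Data.Product.Function.NonDependent.Propositional using (_×-⇔_)
open import Data.Sum using (_⊎_; inj₁; inj₂; [_,_]′; swap)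
import Data.Sum as Sum
open import Data.Sum.Function.Propositional using (_⊎-⇔_)
open import Data.Sum.Properties using (inj₁-injective; inj₂-injective)
open import Data.Unit using (⊤; tt)
open import Data.Vec using (Vec; []; _∷_; lookup; tabulate; _++_)
import Data.Vec as Vec
open import Data.Vec.Properties
  using (lookup-splitAt; lookup-++ˡ; lookup-++ʳ; lookup∘tabulate; lookup-map;
         map-++; map-∘; map-cong; map-id)
open import Function using (_∘_; id)
open import Function.Bundles using (_⇔_; mk⇔; _↣_; mk↣; Injection; Equivalence)
open import Function.Construct.Identity using (↔-id)
import Function.Properties.Equivalence as ⇔
open import Function.Properties.Inverse using (↔⇒↣)
open import Function.Related.TypeIsomorphisms using (¬-cong-⇔)
open import Relation.Binary.Construct.Closure.ReflexiveTransitive using (Star; ε; _◅_; _◅◅_; reverse)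
open import Relation.Binary.Core using (Rel)
open import Relation.Binary.PropositionalEquality
open import Relation.Nullary using (¬_; Dec; yes; no)
open import Relation.Nullary.Decidable using (decidable-stable; map′)

open Structure
open Equivalence using (to; from)

-- Coding of pairs and finite sequences

private
  -- The walk along the antidiagonals.
  advance : ℕ × ℕ → ℕ × ℕ
  advance (zero  , b) = suc b , zero
  advance (suc a , b) = a , suc b

unpair : ℕ → ℕ × ℕ
unpair zero    = zero , zero
unpair (suc n) = advance (unpair n)

unpair-surjective : ∀ a b → ∃[ n ] unpair n ≡ (a , b)
unpair-surjective a b = onDiagonal (a + b) b a refl
  where
  -- The recursion is lexicographic in `s` and `b`: `(a , suc b)` follows `(suc a , b)` on the same
  -- diagonal, and `(suc a , zero)` follows `(zero , a)`, the end of the previous one.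
  onDiagonal : ∀ s b a → a + b ≡ s → ∃[ n ] unpair n ≡ (a , b)
  onDiagonal zero    zero    zero    _  = zero , refl
  onDiagonal zero    (suc b) zero    ()
  onDiagonal (suc s) zero    (suc a) eq =
    let n , p = onDiagonal s a zero (trans (sym (+-identityʳ a)) (suc-injective eq))
    in suc n , cong advance p
  onDiagonal s       (suc b) a       eq =
    let n , p = onDiagonal s b (suc a) (trans (sym (+-suc a b)) eq)
    in suc n , cong advance p

pairing : (ℕ × ℕ) ↣ ℕ
pairing = mk↣ {to = λ (a , b) → proj₁ (unpair-surjective a b)} λ eq →
  trans (sym (proj₂ (unpair-surjective _ _)))
        (trans (cong unpair eq) (proj₂ (unpair-surjective _ _)))

module _ {X : Set} (enum : ℕ → X) where

  -- Every number codes an infinite sequence, the second component of `unpair t` being the code of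
  -- the tail. No length is stored, since only prefixes are used.
  decode : ℕ → ℕ → X
  decode t zero    = enum (proj₁ (unpair t))
  decode t (suc i) = decode (proj₂ (unpair t)) i

  module _ (surjective : ∀ x → ∃[ n ] enum n ≡ x) where

    decode-prefix : ∀ n (f : ℕ → X) → ∃[ t ] (∀ i → i < n → decode t i ≡ f i)
    decode-prefix zero    f = zero , λ _ ()
    decode-prefix (suc n) f with surjective (f zero) | decode-prefix n (f ∘ suc)
    ... | h , p | t , q with unpair-surjective h t
    ...   | u , e = u , λ where
      zero    _        → trans (cong (enum ∘ proj₁) e) p
      (suc i) (s≤s lt) → trans (cong (λ m → decode (proj₂ m) i) e) (q i lt)

    decode-vec : ∀ {k} (w : Vec X k) → ∃[ t ] tabulate {n = k} (decode t ∘ toℕ) ≡ w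
    decode-vec []      = zero , refl
    decode-vec (x ∷ w) with surjective x | decode-vec w
    ... | h , p | t , q with unpair-surjective h t
    ...   | u , e = u , cong₂ _∷_ (trans (cong (enum ∘ proj₁) e) p)
                                  (trans (cong (λ m → tabulate (decode (proj₂ m) ∘ toℕ)) e) q)

-- Ladder forests

-- The parents of the nodes false and true of the level below.
Rung : Set
Rung = Bool × Bool

_!_ : Rung → Bool → Bool
(s , t) ! false = s
(s , t) ! true  = t

Pattern : Set
Pattern = ℕ → Rung

data Ladder : Set where
  top  : Ladder
  node : ℕ → Bool → Ladder

-- node i j lies i + 1 levels below the top, and up g i j is its parent under the pattern g.
up : Pattern → ℕ → Bool → Ladder
up g zero    j = top
up g (suc i) j = node i (g i ! j)

depth : Ladder → ℕ
depth top        = zero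
depth (node i j) = suc i

private
  bit : Bool → ℕ
  bit false = 0
  bit true  = 1

  bit-injective : ∀ {a b} → bit a ≡ bit b → a ≡ b
  bit-injective {false} {false} _ = refl
  bit-injective {true}  {true}  _ = refl

  ladderCode : Ladder → ℕ × ℕ
  ladderCode top        = 0 , 0
  ladderCode (node i j) = suc i , bit j

  ladderCode-injective : ∀ {p q} → ladderCode p ≡ ladderCode q → p ≡ q
  ladderCode-injective {top}      {top}      _  = refl
  ladderCode-injective {node _ _} {node _ _} eq =
    cong₂ node (suc-injective (cong proj₁ eq)) (bit-injective (cong proj₂ eq))

ladderCountable : Ladder ↣ ℕ
ladderCountable = mk↣ (ladderCode-injective ∘ Injection.injective pairing)

module _ (A : Structure) {I : Set} (I↣ℕ : I ↣ ℕ) (c : I → Pattern) where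

  -- In `node` the parent enters through an equation, so that matching never has to unify with a
  -- value of `up`.
  data Parent : Carrier A ⊎ (I × Ladder) → Carrier A ⊎ (I × Ladder) → Set where
    old  : ∀ {a b} → P A a b → Parent (inj₁ a) (inj₁ b)
    top  : ∀ {i} → Parent (inj₂ (i , top)) (inj₁ (r A))
    node : ∀ {i n j q} → up (c i) n j ≡ q → Parent (inj₂ (i , node n j)) (inj₂ (i , q))

  private
    code : Carrier A ⊎ (I × Ladder) → ℕ × ℕ
    code (inj₁ a)       = 0 , Injection.to (countable A) a
    code (inj₂ (i , p)) = suc (Injection.to I↣ℕ i) , Injection.to ladderCountable p

    code-injective : ∀ {x y} → code x ≡ code y → x ≡ y
    code-injective {inj₁ _} {inj₁ _} eq =
      cong inj₁ (Injection.injective (countable A) (cong proj₂ eq))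
    code-injective {inj₂ _} {inj₂ _} eq =
      cong inj₂ (cong₂ _,_ (Injection.injective I↣ℕ (suc-injective (cong proj₁ eq)))
                           (Injection.injective ladderCountable (cong proj₂ eq)))

  attach : Structure
  attach = record
    { Carrier   = Carrier A ⊎ (I × Ladder)
    ; countable = mk↣ (code-injective ∘ Injection.injective pairing)
    ; r         = inj₁ (r A)
    ; P         = Parent
    }

module _ (A : Structure) where

  Below : ℕ → Carrier A → Carrier A → Set
  Below zero    x u = u ≡ x
  Below (suc i) x u = ∃[ w ] P A u w × Below i x w

  -- The two nodes of a level may be named in either order, so one ladder may realise several
  -- patterns. Only the levels up to `node n` are constrained, and they read the first `n` entries
  -- of `g`.
  record Realises (n : ℕ) (g : Pattern) (y : Carrier A) : Set where
    field
      name     : Ladder → Carrier A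
      name-top : name top ≡ y
      name-up  : ∀ i j → i ≤ n → P A (name (node i j)) (name (up g i j))
      distinct : ∀ i → i ≤ n → ¬ name (node i false) ≡ name (node i true)

    name-below : ∀ i j → i ≤ n → Below (suc i) y (name (node i j))
    name-below zero    j le = name top , name-up zero j le , name-top
    name-below (suc i) j le =
      name (node i (g i ! j)) , name-up (suc i) j le , name-below i _ (≤-trans (n≤1+n i) le)

  -- Together `narrow` and `wide` leave exactly two vertices on each level below a child of the
  -- root. Since `dense` concerns finite parts only, countably many existential sentences express
  -- it.
  record IsLadderForest : Set where
    field
      orphan  : ∀ x → ¬ P A (r A) x
      unique  : ∀ {x y z} → P A x y → P A x z → y ≡ z
      rooted  : ∀ x → ∃[ n ] Below n (r A) x
      narrow  : ∀ {i x u v w} → P A x (r A) → Below (suc i) x u → Below (suc i) x v →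
                Below (suc i) x w → ¬ u ≡ v → w ≡ u ⊎ w ≡ v
      wide    : ∀ i {x} → P A x (r A) →
                ∃[ u ] ∃[ v ] ¬ u ≡ v × Below (suc i) x u × Below (suc i) x v
      dense   : ∀ g n → ∃[ y ] P A y (r A) × Realises n g y

module Levels (A : Structure) (F : IsLadderForest A) where
  open IsLadderForest F

  level-unique : ∀ {i j a} → Below A i (r A) a → Below A j (r A) a → i ≡ j
  level-unique {zero}  {zero}  _           _           = refl
  level-unique {zero}  {suc j} refl        (w , p , _) = ⊥-elim (orphan w p)
  level-unique {suc i} {zero}  (w , p , _) refl        = ⊥-elim (orphan w p)
  level-unique {suc i} {suc j} (w , p , b) (v , q , c) with refl ← unique p q =
    cong suc (level-unique b c)

  below-trans : ∀ {i j x y a} → Below A i y a → Below A j x y → Below A (i + j) x a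
  below-trans {zero}  refl        c = c
  below-trans {suc i} (w , p , b) c = w , p , below-trans b c

  below-child : ∀ {k x y z} → Below A k x y → P A x z → Below A (suc k) z y
  below-child {zero}  refl        q = _ , q , refl
  below-child {suc k} (w , p , b) q = w , p , below-child b q

  -- A loop at `x` would give `x` two different levels.
  below-irrefl : ∀ {k x} → ¬ Below A (suc k) x x
  below-irrefl {k} {x} b with n , c ← rooted x =
    m≢1+n+m n (level-unique c (below-trans b c))

  ancestor-unique : ∀ {i x y a} → Below A i x a → Below A i y a → x ≡ y
  ancestor-unique {zero}  refl        refl        = refl
  ancestor-unique {suc i} (w , p , b) (v , q , c) with refl ← unique p q = ancestor-unique b c

  below-depth : ∀ {i j y a} → Below A i y a → Below A j y a → i ≡ j
  below-depth {i} {j} {y} b c with n , d ← rooted y =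
    +-cancelʳ-≡ n i j (level-unique (below-trans b d) (below-trans c d))

  -- Both climbs reach the root after one more step, so they have the same length, and climbs of the
  -- same length from `a` end at the same vertex.
  branch-unique : ∀ {i j x y a} → P A x (r A) → P A y (r A) →
                  Below A i x a → Below A j y a → x ≡ y
  branch-unique {i} {j} p q b c
    with e ← level-unique (below-trans b (_ , p , refl)) (below-trans c (_ , q , refl))
    with refl ← +-cancelʳ-≡ 1 i j e = ancestor-unique b c

-- Ladder forests are trees

module _ {V : Set} (E : Rel V 0ℓ) where

  suffix : ∀ {x y ys} → x ∈ ys → Linked E ys → Unique ys → last ys ≡ just y → ∃[ xs ] Path E x xs y
  suffix {ys = x ∷ ys} (here refl) l u e =
    x ∷ ys , record { starts = refl ; ends = e ; linked = l ; distinct = u }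
  suffix {ys = _ ∷ _ ∷ _} (there m) (_ ∷ l) (_ ∷ u) e = suffix m l u e

  -- If the first vertex recurs on the path found for the rest of the walk, only the part of that
  -- path from the recurrence on is kept.
  walk⇒path : (∀ (P : Set) → Dec P) → ∀ {x y} → Star E x y → ∃[ xs ] Path E x xs y
  walk⇒path lem {x} ε =
    x ∷ [] , record { starts = refl ; ends = refl ; linked = [-] ; distinct = [] ∷ [] }
  walk⇒path lem {x} (e ◅ s) with walk⇒path lem s
  ... | z ∷ zs , record { starts = refl ; ends = ends ; linked = linked ; distinct = distinct }
    with lem (x ∈ z ∷ zs)
  ...   | yes m = suffix m linked distinct ends
  ...   | no ¬m = x ∷ z ∷ zs , record
    { starts = refl ; ends = ends ; linked = e ∷ linked ; distinct = All.¬Any⇒All¬ _ ¬m ∷ distinct }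

module _ (lem : ∀ (P : Set) → Dec P) {A : Structure} (F : IsLadderForest A) where
  open IsLadderForest F
  open Levels A F

  private
    E : Rel (Carrier A) _
    E x y = P A x y ⊎ P A y x

    toRoot : ∀ {n x} → Below A n (r A) x → Star E x (r A)
    toRoot {zero}  refl        = ε
    toRoot {suc n} (w , p , b) = inj₁ p ◅ toRoot b

    -- A path that has once gone down keeps going down, since going up again would backtrack.
    descent : ∀ {z x y} xs → P A x z → Unique (z ∷ x ∷ xs) → Linked E (x ∷ xs) →
              last (x ∷ xs) ≡ just y →
              Below A (suc (length xs)) z y × ∃[ w ] w ∈ z ∷ x ∷ xs × P A y w
    descent [] p _ _ refl = (_ , p , refl) , _ , here refl , p
    descent (x₁ ∷ xs) p ((_ ∷ z≢x₁ ∷ _) ∷ _) (inj₁ q ∷ _) _ = ⊥-elim (z≢x₁ (unique p q))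
    descent (x₁ ∷ xs) p (_ ∷ u) (inj₂ q ∷ l) e with descent xs q u l e
    ... | b , w , w∈ , Pyw = below-child b p , w , there w∈ , Pyw

    -- A path climbs throughout, or its last step goes down from the parent of `y`. This parent is
    -- the first vertex only on a path with one edge, a case kept apart because it closes no cycle.
    ascentOrParent : ∀ {x y} xs → Unique (x ∷ xs) → Linked E (x ∷ xs) → last (x ∷ xs) ≡ just y →
                     Below A (length xs) y x ⊎ (length xs ≡ 1 × P A y x) ⊎ (∃[ w ] w ∈ xs × P A y w)
    ascentOrParent [] _ _ refl = inj₁ refl
    ascentOrParent (x₁ ∷ xs) (_ ∷ u) (inj₁ p ∷ l) e with ascentOrParent xs u l e
    ... | inj₁ b                    = inj₁ (x₁ , p , b)
    ... | inj₂ (inj₁ (_ , q))       = inj₂ (inj₂ (x₁ , here refl , q))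
    ... | inj₂ (inj₂ (w , w∈ , q))  = inj₂ (inj₂ (w , there w∈ , q))
    ascentOrParent (x₁ ∷ []) _ (inj₂ p ∷ _) refl = inj₂ (inj₁ (refl , p))
    ascentOrParent (x₁ ∷ x₂ ∷ xs) ((_ ∷ x≢x₂ ∷ _) ∷ _) (inj₂ p ∷ inj₁ q ∷ l) e =
      ⊥-elim (x≢x₂ (unique p q))
    ascentOrParent (x₁ ∷ x₂ ∷ xs) (_ ∷ u) (inj₂ p ∷ inj₂ q ∷ l) e =
      inj₂ (inj₂ (proj₂ (descent xs q u l e)))

    last∈ : ∀ {y : Carrier A} z zs → last (z ∷ zs) ≡ just y → y ∈ z ∷ zs
    last∈ z []        refl = here refl
    last∈ z (z′ ∷ zs) e    = there (last∈ z′ zs e)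

    -- The climb to the root from a vertex `x` of level `n`. The bound on the levels of the later
    -- vertices guarantees that a child of `x` can be prepended without repetition.
    Lineage : ℕ → Carrier A → List (Carrier A) → Set
    Lineage n x xs = Linked E (x ∷ xs) × last (x ∷ xs) ≡ just (r A) × Unique (x ∷ xs) ×
                     All (λ w → ∃[ m ] m < n × Below A m (r A) w) xs

    extend : ∀ {n x w xs} → P A x w → Below A n (r A) w →
             Lineage n w xs → Lineage (suc n) x (w ∷ xs)
    extend {n} {x} {w} {xs} p b (l , e , u , levels) =
      inj₁ p ∷ l , e , All.map x≢ levels′ ∷ u , levels′
      where
      levels′ : All (λ w → ∃[ m ] m < suc n × Below A m (r A) w) (w ∷ xs)
      levels′ = (n , ≤-refl , b) ∷ All.map (λ (m , lt , d) → m , m<n⇒m<1+n lt , d) levels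
      x≢ : ∀ {v} → ∃[ m ] m < suc n × Below A m (r A) v → ¬ x ≡ v
      x≢ (m , lt , d) refl = <-irrefl (level-unique d (w , p , b)) lt

    lineage : ∀ n {x} → Below A n (r A) x → ∃ (Lineage n x)
    lineage zero    refl        = [] , [-] , refl , [] ∷ [] , []
    lineage (suc n) (w , p , b) = w ∷ _ , extend p b (proj₂ (lineage n b))

    -- If the closing edge makes `x` the parent of `y`, then the path neither climbs to `y` nor
    -- reaches `y` from another parent. If it makes `y` the parent of `x`, a first step up arrives
    -- at `y` too early, and a first step down puts `y` below its own child.
    acyclic : Acyclic E
    acyclic {xs = x ∷ x₁ ∷ x₂ ∷ xs}
            record { starts = refl ; ends = e ; linked = l ; distinct = x∉ ∷ u }
            (s≤s (s≤s (s≤s _))) (inj₁ p) with ascentOrParent (x₁ ∷ x₂ ∷ xs) (x∉ ∷ u) l e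
    ... | inj₁ b                   = below-irrefl (below-child b p)
    ... | inj₂ (inj₁ (() , _))
    ... | inj₂ (inj₂ (w , w∈ , q)) = All.lookup x∉ w∈ (unique p q)
    acyclic {xs = x ∷ x₁ ∷ x₂ ∷ xs}
            record { starts = refl ; ends = e ; linked = inj₁ q ∷ l ; distinct = x∉ ∷ x₁∉ ∷ u }
            (s≤s (s≤s (s≤s _))) (inj₂ p) = All.lookup x₁∉ (last∈ x₂ xs e) (unique q p)
    acyclic {xs = x ∷ x₁ ∷ x₂ ∷ xs}
            record { starts = refl ; ends = e ; linked = inj₂ q ∷ l ; distinct = u }
            (s≤s (s≤s (s≤s _))) (inj₂ p) =
      below-irrefl (below-trans (proj₁ (descent (x₂ ∷ xs) q u l e)) (_ , p , refl))

  ladderForest⇒tree : IsTree A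
  ladderForest⇒tree = record
    { E           = E
    ; symmetric   = swap
    ; irreflexive = λ { refl (inj₁ p) → below-irrefl (_ , p , refl)
                      ; refl (inj₂ p) → below-irrefl (_ , p , refl) }
    ; connected   = λ x y → walk⇒path E lem
        (toRoot (proj₂ (rooted x)) ◅◅ reverse swap (toRoot (proj₂ (rooted y))))
    ; acyclic     = acyclic
    ; parent      = λ x y → mk⇔ parent⇒ (λ (xs , π) → ⇒parent π)
    }
    where
    parent⇒ : ∀ {x y} → P A x y → IsParent E (r A) x y
    parent⇒ {x} {y} p with n , b ← rooted y with lineage n b
    ... | xs , L with l , e , u , _ ← extend p b L =
      xs , record { starts = refl ; ends = e ; linked = l ; distinct = u }
    ⇒parent : ∀ {x y xs} → Path E x (x ∷ y ∷ xs) (r A) → P A x y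
    ⇒parent record { linked = inj₁ p ∷ _ } = p
    -- A path that starts downwards ends below `x`, but the root has no parent.
    ⇒parent {xs = xs} record { linked = inj₂ p ∷ l ; distinct = u ; ends = e }
      with w , q , _ ← proj₁ (descent xs p u l e) = ⊥-elim (orphan w q)

-- Prenex existential formulas

module _ (A : Structure) where

  sat-∃* : ∀ k {n} (φ : Formula (k + n)) v →
           Sat A (∃* k φ) v ⇔ ∃ λ (w : Vec (Carrier A) k) → Sat A φ (w ++ v)
  sat-∃* zero    φ v = mk⇔ ([] ,_) (λ { ([] , s) → s })
  sat-∃* (suc k) {n} φ v = mk⇔
    (λ s → let w , x , t = to (sat-∃* k {n} (∃ᶠ φ) v) s in x ∷ w , t)
    (λ { (x ∷ w , t) → from (sat-∃* k {n} (∃ᶠ φ) v) (w , x , t) })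

  sat-∀* : ∀ k {n} (φ : Formula (k + n)) v →
           Sat A (∀* k φ) v ⇔ ((w : Vec (Carrier A) k) → Sat A φ (w ++ v))
  sat-∀* zero    φ v = mk⇔ (λ { s [] → s }) (λ s → s [])
  sat-∀* (suc k) {n} φ v = mk⇔
    (λ { s (x ∷ w) → to (sat-∀* k {n} (∀ᶠ φ) v) s w x })
    (λ s → from (sat-∀* k {n} (∀ᶠ φ) v) λ w x → s (x ∷ w))

module _ {m n : ℕ} (f : Fin m → Fin n) where

  renameTerm : Term m → Term n
  renameTerm (var i) = var (f i)
  renameTerm root    = root

  -- The recursion follows the proof of quantifier-freeness, so it never passes a binder.
  rename : ∀ {φ} → QuantifierFree φ → ∃[ ψ ] QuantifierFree {n} ψ
  rename (s ≐ t)  = _ , renameTerm s ≐ renameTerm t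
  rename (Pᶠ s t) = _ , Pᶠ (renameTerm s) (renameTerm t)
  rename ⊤ᶠ       = _ , ⊤ᶠ
  rename ⊥ᶠ       = _ , ⊥ᶠ
  rename (¬ᶠ q)   = _ , ¬ᶠ proj₂ (rename q)
  rename (q ∧ᶠ q′) = _ , proj₂ (rename q) ∧ᶠ proj₂ (rename q′)
  rename (q ∨ᶠ q′) = _ , proj₂ (rename q) ∨ᶠ proj₂ (rename q′)

  module _ (A : Structure) {v : Vec (Carrier A) m} {w : Vec (Carrier A) n}
           (eq : ∀ i → lookup v i ≡ lookup w (f i)) where

    ⟦renameTerm⟧ : ∀ t → ⟦_⟧ A t v ≡ ⟦_⟧ A (renameTerm t) w
    ⟦renameTerm⟧ (var i) = eq i
    ⟦renameTerm⟧ root    = refl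

    sat-rename : ∀ {φ} (q : QuantifierFree φ) → Sat A φ v ⇔ Sat A (proj₁ (rename q)) w
    sat-rename (s ≐ t)   rewrite ⟦renameTerm⟧ s | ⟦renameTerm⟧ t = ⇔.refl
    sat-rename (Pᶠ s t)  rewrite ⟦renameTerm⟧ s | ⟦renameTerm⟧ t = ⇔.refl
    sat-rename ⊤ᶠ        = ⇔.refl
    sat-rename ⊥ᶠ        = ⇔.refl
    sat-rename (¬ᶠ q)    = ¬-cong-⇔ (sat-rename q)
    sat-rename (q ∧ᶠ q′) = sat-rename q ×-⇔ sat-rename q′
    sat-rename (q ∨ᶠ q′) = sat-rename q ⊎-⇔ sat-rename q′

Predicate : ℕ → Set₁
Predicate n = ∀ A → Vec (Carrier A) n → Set

-- One prenex formula has to define `R` in all structures. The closure properties that follow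
-- assemble the axioms, with the shifting of variables done once and for all.
record Existential {n} (R : Predicate n) : Set₁ where
  field
    size           : ℕ
    matrix         : Formula (size + n)
    quantifierFree : QuantifierFree matrix
    sat            : ∀ A v → R A v ⇔ ∃ λ (w : Vec (Carrier A) size) → Sat A matrix (w ++ v)

open Existential

atom : ∀ {n φ} → QuantifierFree {n} φ → Existential (λ A v → Sat A φ v)
atom {φ = φ} q = record
  { size = 0 ; matrix = φ ; quantifierFree = q
  ; sat = λ A v → mk⇔ ([] ,_) (λ { ([] , s) → s }) }

module _ {n : ℕ} {R S : Predicate n} (ρ : Existential R) (σ : Existential S) where
  private
    k = size ρ
    l = size σ

    left : Fin (k + n) → Fin ((k + l) + n)
    left i = [ (λ a → (a ↑ˡ l) ↑ˡ n) , (k + l) ↑ʳ_ ]′ (splitAt k i)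

    right : Fin (l + n) → Fin ((k + l) + n)
    right i = [ (λ a → (k ↑ʳ a) ↑ˡ n) , (k + l) ↑ʳ_ ]′ (splitAt l i)

    module _ {X : Set} (w : Vec X k) (w′ : Vec X l) (v : Vec X n) where

      lookup-left : ∀ i → lookup (w ++ v) i ≡ lookup ((w ++ w′) ++ v) (left i)
      lookup-left i rewrite lookup-splitAt k w v i with splitAt k i
      ... | inj₁ a = sym (trans (lookup-++ˡ (w ++ w′) v (a ↑ˡ l)) (lookup-++ˡ w w′ a))
      ... | inj₂ b = sym (lookup-++ʳ (w ++ w′) v b)

      lookup-right : ∀ i → lookup (w′ ++ v) i ≡ lookup ((w ++ w′) ++ v) (right i)
      lookup-right i rewrite lookup-splitAt l w′ v i with splitAt l i
      ... | inj₁ a = sym (trans (lookup-++ˡ (w ++ w′) v (k ↑ʳ a)) (lookup-++ʳ w w′ a))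
      ... | inj₂ b = sym (lookup-++ʳ (w ++ w′) v b)

  infixr 7 _∧ᴱ_

  _∧ᴱ_ : Existential (λ A v → R A v × S A v)
  _∧ᴱ_ = record
    { size           = k + l
    ; matrix         = _
    ; quantifierFree = proj₂ (rename left (quantifierFree ρ)) ∧ᶠ proj₂ (rename right (quantifierFree σ))
    ; sat            = λ A v → mk⇔
        (λ (a , b) →
          let w  , s = to (sat ρ A v) a
              w′ , t = to (sat σ A v) b
          in w ++ w′ , to (sat-rename left A (lookup-left w w′ v) (quantifierFree ρ)) s
                     , to (sat-rename right A (lookup-right w w′ v) (quantifierFree σ)) t)
        (λ (u , s , t) → split A v u s t)
    }
    where
    split : ∀ A v (u : Vec (Carrier A) (k + l)) →
            Sat A (proj₁ (rename left (quantifierFree ρ))) (u ++ v) →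
            Sat A (proj₁ (rename right (quantifierFree σ))) (u ++ v) → R A v × S A v
    split A v u s t with w , w′ , refl ← Vec.splitAt k u =
      from (sat ρ A v) (w , from (sat-rename left A (lookup-left w w′ v) (quantifierFree ρ)) s) ,
      from (sat σ A v) (w′ , from (sat-rename right A (lookup-right w w′ v) (quantifierFree σ)) t)

module _ {n : ℕ} {R : Predicate (suc n)} (ρ : Existential R) where
  private
    k = size ρ

    -- The variable `x` stands behind the block in `w ++ x ∷ v` and becomes the first variable of
    -- the enlarged block.
    hoist : Fin (k + suc n) → Fin (suc k + n)
    hoist i with splitAt k i
    ... | inj₁ a       = suc a ↑ˡ n
    ... | inj₂ zero    = zero
    ... | inj₂ (suc b) = suc k ↑ʳ b

    lookup-hoist : ∀ {X : Set} (w : Vec X k) x (v : Vec X n) i →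
                   lookup (w ++ x ∷ v) i ≡ lookup ((x ∷ w) ++ v) (hoist i)
    lookup-hoist w x v i rewrite lookup-splitAt k w (x ∷ v) i with splitAt k i
    ... | inj₁ a       = sym (lookup-++ˡ (x ∷ w) v (suc a))
    ... | inj₂ zero    = refl
    ... | inj₂ (suc b) = sym (lookup-++ʳ (x ∷ w) v b)

  ∃ᴱ : Existential (λ A v → ∃[ x ] R A (x ∷ v))
  ∃ᴱ = record
    { size           = suc k
    ; matrix         = _
    ; quantifierFree = proj₂ (rename hoist (quantifierFree ρ))
    ; sat            = λ A v → mk⇔
        (λ (x , a) → let w , s = to (sat ρ A (x ∷ v)) a in
          x ∷ w , to (sat-rename hoist A (lookup-hoist w x v) (quantifierFree ρ)) s)
        (λ { (x ∷ w , s) → x , from (sat ρ A (x ∷ v))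
          (w , from (sat-rename hoist A (lookup-hoist w x v) (quantifierFree ρ)) s) })
    }

record Clause (Q : Structure → Set) : Set₁ where
  field
    sentence : Sentence
    is∀Σ     : Is∀Σ (fin 2) sentence
    holds    : ∀ A → A ⊨ sentence ⇔ Q A

mapClause : ∀ {Q Q′} → (∀ A → Q A ⇔ Q′ A) → Clause Q → Clause Q′
mapClause Q⇔Q′ c = record
  { sentence = sentence
  ; is∀Σ     = is∀Σ
  ; holds    = λ A → ⇔.trans (holds A) (Q⇔Q′ A)
  }
  where open Clause c

module _ (n : ℕ) {R : ℕ → Predicate (n + 0)} (ρ : ∀ i → Existential (R i)) where

  -- The general shape of a conjunct of a Π₂ sentence, with a Σ₁ formula under the universal block.
  ∀⋁ : Clause (λ A → ∀ (w : Vec (Carrier A) n) → ∃[ i ] R i A (w ++ []))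
  ∀⋁ = record
    { sentence = ∀* n body
    ; is∀Σ     = block (s≤s (s≤s z≤)) n
                   (⋁∃ λ i → block (s≤s z≤) (size (ρ i)) (qf z≤ (quantifierFree (ρ i))))
    ; holds    = λ A → mk⇔
        (λ s w → let i , t = to (sat-∀* A n body []) s w in
          i , from (sat (ρ i) A _) (to (sat-∃* A (size (ρ i)) (matrix (ρ i)) (w ++ [])) t))
        (λ q → from (sat-∀* A n body []) λ w → let i , a = q w in
          i , from (sat-∃* A (size (ρ i)) (matrix (ρ i)) (w ++ [])) (to (sat (ρ i) A _) a))
    }
    where
    body : Formula (n + 0)
    body = ⋁ λ i → ∃* (size (ρ i)) (matrix (ρ i))

∀ᴱ : ∀ n {R : Predicate (n + 0)} → Existential R →
     Clause (λ A → ∀ (w : Vec (Carrier A) n) → R A (w ++ []))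
∀ᴱ n ρ = mapClause (λ A → mk⇔ (λ q w → proj₂ (q w)) (λ q w → 0 , q w)) (∀⋁ n (λ _ → ρ))

module _ {n : ℕ} {R : Predicate n} (ρ : Existential R) where
  private
    k = size ρ
    negated : QuantifierFree _
    negated = ¬ᶠ proj₂ (rename (_↑ˡ 0) (quantifierFree ρ))

  -- Negation turns the existential block into a universal one, which merges with the outer
  -- quantifiers.
  ∀¬ᴱ : Clause (λ A → ∀ v → ¬ R A v)
  ∀¬ᴱ = mapClause (λ A → mk⇔
      (λ q v a → let w , s = to (sat ρ A v) a in
        q (w ++ v) (to (renamed A (w ++ v)) s))
      (λ q u s → prefix A q u (from (renamed A u) s)))
    (∀ᴱ (k + n) (atom negated))
    where
    renamed : ∀ A (u : Vec (Carrier A) (k + n)) → Sat A (matrix ρ) u ⇔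
              Sat A (proj₁ (rename (_↑ˡ 0) (quantifierFree ρ))) (u ++ [])
    renamed A u = sat-rename (_↑ˡ 0) A (λ i → sym (lookup-++ˡ u [] i)) (quantifierFree ρ)
    prefix : ∀ A → (∀ v → ¬ R A v) → ∀ u → ¬ Sat A (matrix ρ) u
    prefix A q u s with w , v , refl ← Vec.splitAt k u = q v (from (sat ρ A v) (w , s))

-- Axioms of ladder forests

choose : {X : Set} → X → X → Bool → X
choose x y false = x
choose x y true  = y

choose-η : {X : Set} (f : Bool → X) → ∀ b → choose (f false) (f true) b ≡ f b
choose-η f false = refl
choose-η f true  = refl

module _ (A : Structure) where

  -- A form of `Realises` without a naming function: the two nodes are quantified level by level, as
  -- a first-order formula can do.
  Descends : ℕ → Pattern → Carrier A → Carrier A → Set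
  Descends zero    g u v = ⊤
  Descends (suc n) g u v = ∃[ u′ ] ∃[ v′ ] ¬ u′ ≡ v′ ×
    P A u′ (choose u v (g 0 ! false)) × P A v′ (choose u v (g 0 ! true)) × Descends n (g ∘ suc) u′ v′

  Carries : ℕ → Pattern → Carrier A → Set
  Carries n g y = ∃[ u ] ∃[ v ] ¬ u ≡ v × P A u y × P A v y × Descends n g u v

module _ {A : Structure} where

  descends⇒names : ∀ n {g u v} → Descends A n g u v → ∃ λ (f : ℕ → Bool → Carrier A) →
                   (∀ j → f 0 j ≡ choose u v j) ×
                   (∀ i j → i < n → P A (f (suc i) j) (f i (g i ! j))) ×
                   (∀ i → i < n → ¬ f (suc i) false ≡ f (suc i) true)
  descends⇒names zero    {g} {u} {v} _ = (λ _ → choose u v) , (λ _ → refl) , (λ _ _ ()) , λ _ ()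
  descends⇒names (suc n) {g} {u} {v} (u′ , v′ , u′≢v′ , p , q , d)
    with f , f0 , f-up , f-distinct ← descends⇒names n d = f′ , (λ _ → refl) , f′-up , f′-distinct
    where
    f′ : ℕ → Bool → Carrier A
    f′ zero    = choose u v
    f′ (suc i) = f i
    f′-up : ∀ i j → i < suc n → P A (f′ (suc i) j) (f′ i (g i ! j))
    f′-up zero    false _        = subst (λ a → P A a _) (sym (f0 false)) p
    f′-up zero    true  _        = subst (λ a → P A a _) (sym (f0 true)) q
    f′-up (suc i) j     (s≤s lt) = f-up i j lt
    f′-distinct : ∀ i → i < suc n → ¬ f′ (suc i) false ≡ f′ (suc i) true
    f′-distinct zero    _        e = u′≢v′ (trans (sym (f0 false)) (trans e (f0 true)))
    f′-distinct (suc i) (s≤s lt) e = f-distinct i lt e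

  carries⇒realises : ∀ {n g y} → Carries A n g y → Realises A n g y
  carries⇒realises {n} {g} {y} (u , v , u≢v , p , q , d)
    with f , f0 , f-up , f-distinct ← descends⇒names n d = record
    { name     = name
    ; name-top = refl
    ; name-up  = name-up
    ; distinct = distinct
    }
    where
    name : Ladder → Carrier A
    name top        = y
    name (node i j) = f i j
    name-up : ∀ i j → i ≤ n → P A (name (node i j)) (name (up g i j))
    name-up zero    false _  = subst (λ a → P A a y) (sym (f0 false)) p
    name-up zero    true  _  = subst (λ a → P A a y) (sym (f0 true)) q
    name-up (suc i) j     lt = f-up i j lt
    distinct : ∀ i → i ≤ n → ¬ name (node i false) ≡ name (node i true)
    distinct zero    _  e = u≢v (trans (sym (f0 false)) (trans e (f0 true)))
    distinct (suc i) lt e = f-distinct i lt e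

  names⇒descends : ∀ n g (f : ℕ → Bool → Carrier A) →
                   (∀ i j → i < n → P A (f (suc i) j) (f i (g i ! j))) →
                   (∀ i → i < n → ¬ f (suc i) false ≡ f (suc i) true) →
                   Descends A n g (f 0 false) (f 0 true)
  names⇒descends zero    g f up distinct = tt
  names⇒descends (suc n) g f up distinct =
    f 1 false , f 1 true , distinct 0 (s≤s z≤n) , edge false , edge true ,
    names⇒descends n (g ∘ suc) (f ∘ suc)
      (λ i j lt → up (suc i) j (s≤s lt)) (λ i lt → distinct (suc i) (s≤s lt))
    where
    edge : ∀ j → P A (f 1 j) (choose (f 0 false) (f 0 true) (g 0 ! j))
    edge j = subst (P A (f 1 j)) (sym (choose-η (f 0) (g 0 ! j))) (up 0 j (s≤s z≤n))

  realises⇒carries : ∀ {n g y} → Realises A n g y → Carries A n g y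
  realises⇒carries {n} {g} R =
    name (node 0 false) , name (node 0 true) , distinct 0 z≤n ,
    subst (P A _) name-top (name-up 0 false z≤n) , subst (P A _) name-top (name-up 0 true z≤n) ,
    names⇒descends n g (λ i j → name (node i j))
      (λ i j → name-up (suc i) j) (λ i → distinct (suc i))
    where open Realises R

rungs : ℕ → Rung
rungs 0 = false , false
rungs 1 = false , true
rungs 2 = true , false
rungs _ = true , true

rungs-surjective : ∀ x → ∃[ n ] rungs n ≡ x
rungs-surjective (false , false) = 0 , refl
rungs-surjective (false , true)  = 1 , refl
rungs-surjective (true , false)  = 2 , refl
rungs-surjective (true , true)   = 3 , refl

module _ (A : Structure) where

  -- An implication written as a countable disjunction: index zero negates the premise, and all
  -- other indices repeat the conclusion.
  WideOrNotTop : ℕ → Carrier A → ℕ → Set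
  WideOrNotTop i x zero    = ¬ P A x (r A)
  WideOrNotTop i x (suc _) = ∃[ u ] ∃[ v ] ¬ u ≡ v × Below A (suc i) x u × Below A (suc i) x v

  -- The first number selects the kind of axiom. The second is a level or, for density, codes a
  -- pattern together with a length. In kind 2 the bound variable `o` names the root, because
  -- `belowᴱ` takes variables only.
  Axiom : ℕ × ℕ → Set
  Axiom (0 , _) = ∀ x → ¬ P A (r A) x
  Axiom (1 , _) = ∀ x y z → ¬ (P A x y × P A x z × ¬ y ≡ z)
  Axiom (2 , _) = ∀ x → ∃[ n ] ∃[ o ] o ≡ r A × Below A n o x
  Axiom (3 , i) = ∀ x u v w → ¬ (P A x (r A) × Below A (suc i) x u × Below A (suc i) x v ×
                                 Below A (suc i) x w × ¬ u ≡ v × ¬ w ≡ u × ¬ w ≡ v)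
  Axiom (4 , i) = ∀ x → ∃ (WideOrNotTop i x)
  Axiom (_ , m) = ∃[ y ] P A y (r A) ×
    Carries A (proj₂ (unpair m)) (decode rungs (proj₁ (unpair m))) y

belowᴱ : ∀ i {n} (s t : Fin n) → Existential (λ A v → Below A i (lookup v s) (lookup v t))
belowᴱ zero    s t = atom (var t ≐ var s)
belowᴱ (suc i) s t = ∃ᴱ (atom (Pᶠ (var (suc t)) (var 0F)) ∧ᴱ belowᴱ i (suc s) 0F)

edgeᴱ : ∀ b {n} (s u v : Fin n) →
        Existential (λ A w → P A (lookup w s) (choose (lookup w u) (lookup w v) b))
edgeᴱ false s u v = atom (Pᶠ (var s) (var u))
edgeᴱ true  s u v = atom (Pᶠ (var s) (var v))

descendsᴱ : ∀ n g {m} (u v : Fin m) → Existential (λ A w → Descends A n g (lookup w u) (lookup w v))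
descendsᴱ zero    g u v = atom ⊤ᶠ
descendsᴱ (suc n) g u v = ∃ᴱ (∃ᴱ (atom (¬ᶠ (var 1F ≐ var 0F)) ∧ᴱ
  edgeᴱ (g 0 ! false) 1F (suc (suc u)) (suc (suc v)) ∧ᴱ
  edgeᴱ (g 0 ! true) 0F (suc (suc u)) (suc (suc v)) ∧ᴱ
  descendsᴱ n (g ∘ suc) 1F 0F))

clause : ∀ p → Clause (λ A → Axiom A p)
clause (0 , _) = mapClause (λ A → mk⇔ (λ q x → q (x ∷ [])) (λ { q (x ∷ []) → q x }))
  (∀ᴱ 1 (atom (¬ᶠ Pᶠ root (var 0F))))
clause (1 , _) = mapClause
  (λ A → mk⇔ (λ q x y z → q (x ∷ y ∷ z ∷ [])) (λ { q (x ∷ y ∷ z ∷ []) → q x y z }))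
  (∀ᴱ 3 (atom (¬ᶠ (Pᶠ (var 0F) (var 1F) ∧ᶠ Pᶠ (var 0F) (var 2F) ∧ᶠ ¬ᶠ (var 1F ≐ var 2F)))))
clause (2 , _) = mapClause (λ A → mk⇔ (λ q x → q (x ∷ [])) (λ { q (x ∷ []) → q x }))
  (∀⋁ 1 (λ n → ∃ᴱ (atom (var 0F ≐ root) ∧ᴱ belowᴱ n 0F 1F)))
clause (3 , i) = mapClause
  (λ A → mk⇔ (λ q x u v w → q (x ∷ u ∷ v ∷ w ∷ [])) (λ { q (x ∷ u ∷ v ∷ w ∷ []) → q x u v w }))
  (∀¬ᴱ (atom (Pᶠ (var 0F) root) ∧ᴱ belowᴱ (suc i) 0F 1F ∧ᴱ belowᴱ (suc i) 0F 2F ∧ᴱ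
        belowᴱ (suc i) 0F 3F ∧ᴱ atom (¬ᶠ (var 1F ≐ var 2F) ∧ᶠ ¬ᶠ (var 3F ≐ var 1F) ∧ᶠ ¬ᶠ (var 3F ≐ var 2F))))
clause (4 , i) = mapClause (λ A → mk⇔ (λ q x → q (x ∷ [])) (λ { q (x ∷ []) → q x }))
  (∀⋁ 1 {λ k A v → WideOrNotTop A i (lookup v 0F) k} λ where
    zero    → atom (¬ᶠ Pᶠ (var 0F) root)
    (suc _) → ∃ᴱ (∃ᴱ (atom (¬ᶠ (var 1F ≐ var 0F)) ∧ᴱ belowᴱ (suc i) 2F 1F ∧ᴱ belowᴱ (suc i) 2F 0F)))
clause (suc (suc (suc (suc (suc _)))) , m) = mapClause (λ A → mk⇔ (λ q → q []) (λ { q [] → q }))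
  (∀ᴱ 0 (∃ᴱ (atom (Pᶠ (var 0F) root) ∧ᴱ ∃ᴱ (∃ᴱ (atom (¬ᶠ (var 1F ≐ var 0F)) ∧ᴱ
    atom (Pᶠ (var 1F) (var 2F)) ∧ᴱ atom (Pᶠ (var 0F) (var 2F)) ∧ᴱ
    descendsᴱ (proj₂ (unpair m)) (decode rungs (proj₁ (unpair m))) 1F 0F)))))

ladderForest : Sentence
ladderForest = ⋀ λ m → Clause.sentence (clause (unpair m))

ladderForest-Π₂ : IsΠ (fin 2) ladderForest
ladderForest-Π₂ = ⋀∀ λ m → Clause.is∀Σ (clause (unpair m))

sat-ladderForest : ∀ A → A ⊨ ladderForest ⇔ (∀ p → Axiom A p)
sat-ladderForest A = mk⇔
  (λ s p@(a , b) → let m , e = unpair-surjective a b in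
    subst (Axiom A) e (to (Clause.holds (clause (unpair m)) A) (s m)))
  (λ q m → from (Clause.holds (clause (unpair m)) A) (q (unpair m)))

realises-cong : ∀ {A n g h y} → (∀ i → i < n → g i ≡ h i) → Realises A n g y → Realises A n h y
realises-cong {A} {n} {g} {h} g≡h R = record
  { name     = name
  ; name-top = name-top
  ; name-up  = λ i j le →
      subst (λ p → P A (name (node i j)) (name p)) (up-cong i j le) (name-up i j le)
  ; distinct = distinct
  }
  where
  open Realises R
  up-cong : ∀ i j → i ≤ n → up g i j ≡ up h i j
  up-cong zero    j _  = refl
  up-cong (suc i) j lt = cong (λ x → node i (x ! j)) (g≡h i lt)

module _ (lem : ∀ (P : Set) → Dec P) (A : Structure) where

  -- Excluded middle turns the negative axioms of kinds 1 and 3 into positive statements and decides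
  -- the disjunction in kind 4.
  axioms⇔isLadderForest : (∀ p → Axiom A p) ⇔ IsLadderForest A
  axioms⇔isLadderForest = mk⇔ ⇒ ⇐
    where
    ⇒ : (∀ p → Axiom A p) → IsLadderForest A
    ⇒ ax = record
      { orphan = ax (0 , 0)
      ; unique = λ {x} {y} {z} p q → decidable-stable (lem _) λ ne → ax (1 , 0) x y z (p , q , ne)
      ; rooted = λ x → rootedAt (ax (2 , 0) x)
      ; narrow = λ {i} {x} {u} {v} {w} p a b c ne → decidable-stable (lem _) λ ¬e →
          ax (3 , i) x u v w (p , a , b , c , ne , ¬e ∘ inj₁ , ¬e ∘ inj₂)
      ; wide   = λ i {x} p → twoNodes p (ax (4 , i) x)
      ; dense  = dense
      }
      where
      rootedAt : ∀ {x} → ∃[ n ] ∃[ o ] o ≡ r A × Below A n o x → ∃[ n ] Below A n (r A) x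
      rootedAt (n , _ , refl , b) = n , b
      twoNodes : ∀ {i x} → P A x (r A) → ∃ (WideOrNotTop A i x) →
              ∃[ u ] ∃[ v ] ¬ u ≡ v × Below A (suc i) x u × Below A (suc i) x v
      twoNodes p (zero  , ¬p) = ⊥-elim (¬p p)
      twoNodes p (suc _ , w)  = w
      dense : ∀ g n → ∃[ y ] P A y (r A) × Realises A n g y
      -- Only the first `n` entries matter, so a decoded pattern can take the place of `g`.
      dense g n with decode-prefix rungs rungs-surjective n g
      ... | t , agree with unpair-surjective t n
      ...   | m , e with ax (5 , m)
      ...     | y , p , c rewrite e = y , p , realises-cong agree (carries⇒realises c)
    ⇐ : IsLadderForest A → ∀ p → Axiom A p
    ⇐ F = λ where
        (0 , _) → orphan
        (1 , _) → λ x y z (p , q , ne) → ne (unique p q)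
        (2 , _) → λ x → let n , b = rooted x in n , r A , refl , b
        (3 , i) → λ x u v w (p , a , b , c , ne , ne₁ , ne₂) → [ ne₁ , ne₂ ]′ (narrow p a b c ne)
        (4 , i) → wide′ i
        (suc (suc (suc (suc (suc _)))) , m) →
          let y , p , R = dense (decode rungs (proj₁ (unpair m))) (proj₂ (unpair m)) in
          y , p , realises⇒carries R
      where
      open IsLadderForest F
      wide′ : ∀ i x → ∃ (WideOrNotTop A i x)
      wide′ i x with lem (P A x (r A))
      ... | yes p = 1 , wide i p
      ... | no ¬p = 0 , ¬p

-- A ladder forest

realises-attached : ∀ A {I} (I↣ℕ : I ↣ ℕ) c i n → Realises (attach A I↣ℕ c) n (c i) (inj₂ (i , top))
realises-attached A I↣ℕ c i n = record
  { name     = λ p → inj₂ (i , p)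
  ; name-top = refl
  ; name-up  = λ _ _ _ → node refl
  ; distinct = λ _ _ ()
  }

point : Structure
point = record
  { Carrier   = ⊤
  ; countable = mk↣ {to = λ _ → 0} λ _ → refl
  ; r         = tt
  ; P         = λ _ _ → ⊥
  }

-- One ladder for each code. Countably many ladders suffice for density because the decoded patterns
-- exhaust all finite prefixes.
model : Structure
model = attach point (mk↣ {to = id} id) (decode rungs)

private
  model-orphan : ∀ x → ¬ P model (r model) x
  model-orphan _ (old ())

  model-unique : ∀ {x y z} → P model x y → P model x z → y ≡ z
  model-unique (old ()) _
  model-unique top         top         = refl
  model-unique (node refl) (node refl) = refl

  model-rooted : ∀ x → ∃[ n ] Below model n (r model) x
  model-rooted (inj₁ _)              = 0 , refl
  model-rooted (inj₂ (k , top))      = 1 , _ , top , refl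
  model-rooted (inj₂ (k , node i j)) = suc (suc i) , rungBelow i j
    where
    rungBelow : ∀ i j → Below model (suc (suc i)) (r model) (inj₂ (k , node i j))
    rungBelow zero    j = _ , node refl , _ , top , refl
    rungBelow (suc i) j = _ , node refl , rungBelow i _

  modelRung : ∀ {i k} u → Below model (suc i) (inj₂ (k , top)) u → ∃[ j ] u ≡ inj₂ (k , node i j)
  modelRung {zero}  (inj₁ _) (_ , old () , _)
  modelRung {zero}  (inj₂ (_ , node zero    j)) (_ , node refl , refl) = j , refl
  modelRung {zero}  (inj₂ (_ , node (suc _) j)) (_ , node refl , ())
  modelRung {suc i} u (w , p , b) with modelRung w b
  modelRung {suc i} (inj₂ (_ , node (suc _) j)) (_ , node refl , b) | _ , refl = j , refl

  model-narrow : ∀ {i x u v w} → P model x (r model) → Below model (suc i) x u →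
                 Below model (suc i) x v → Below model (suc i) x w → ¬ u ≡ v → w ≡ u ⊎ w ≡ v
  model-narrow {u = u} {v} {w} top a b c u≢v with modelRung u a | modelRung v b | modelRung w c
  ... | false , refl | false , refl | _            = ⊥-elim (u≢v refl)
  ... | true  , refl | true  , refl | _            = ⊥-elim (u≢v refl)
  ... | false , refl | true  , refl | false , refl = inj₁ refl
  ... | false , refl | true  , refl | true  , refl = inj₂ refl
  ... | true  , refl | false , refl | false , refl = inj₂ refl
  ... | true  , refl | false , refl | true  , refl = inj₁ refl

model-isLadderForest : IsLadderForest model
model-isLadderForest = record
  { orphan = model-orphan
  ; unique = model-unique
  ; rooted = model-rooted
  ; narrow = model-narrow
  ; wide   = wide
  ; dense  = dense
  }
  where
  wide : ∀ i {x} → P model x (r model) →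
         ∃[ u ] ∃[ v ] ¬ u ≡ v × Below model (suc i) x u × Below model (suc i) x v
  wide i (top {k}) = _ , _ , distinct i ≤-refl , name-below i false ≤-refl , name-below i true ≤-refl
    where open Realises (realises-attached point (mk↣ {to = id} id) (decode rungs) k i)
  dense : ∀ g n → ∃[ y ] P model y (r model) × Realises model n g y
  dense g n = let t , agree = decode-prefix rungs rungs-surjective n g in
    inj₂ (t , top) , top , realises-cong agree (realises-attached point _ (decode rungs) t n)

-- Partial isomorphisms

-- The partial map is given by its graph; `∼-≡` makes it single-valued and injective.
record IsPartialIso (A B : Structure) (_∼_ : Carrier A → Carrier B → Set) : Set where
  field
    ∼-root : r A ∼ r B
    ∼-≡    : ∀ {a a′ b b′} → a ∼ b → a′ ∼ b′ → a ≡ a′ ⇔ b ≡ b′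
    ∼-P    : ∀ {a a′ b b′} → a ∼ b → a′ ∼ b′ → P A a a′ ⇔ P B b b′

module _ {A B : Structure} {_∼_ : Carrier A → Carrier B → Set} (iso : IsPartialIso A B _∼_) where
  open IsPartialIso iso

  module _ {n} {v : Vec (Carrier A) n} {w : Vec (Carrier B) n}
           (v∼w : ∀ i → lookup v i ∼ lookup w i) where

    ⟦⟧-∼ : ∀ t → ⟦_⟧ A t v ∼ ⟦_⟧ B t w
    ⟦⟧-∼ (var i) = v∼w i
    ⟦⟧-∼ root    = ∼-root

    sat-∼ : ∀ {φ} → QuantifierFree φ → Sat A φ v ⇔ Sat B φ w
    sat-∼ (s ≐ t)   = ∼-≡ (⟦⟧-∼ s) (⟦⟧-∼ t)
    sat-∼ (Pᶠ s t)  = ∼-P (⟦⟧-∼ s) (⟦⟧-∼ t)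
    sat-∼ ⊤ᶠ        = ⇔.refl
    sat-∼ ⊥ᶠ        = ⇔.refl
    sat-∼ (¬ᶠ q)    = ¬-cong-⇔ (sat-∼ q)
    sat-∼ (q ∧ᶠ q′) = sat-∼ q ×-⇔ sat-∼ q′
    sat-∼ (q ∨ᶠ q′) = sat-∼ q ⊎-⇔ sat-∼ q′

-- The existential part of a true Σ₁ formula has finitely many witnesses, and the formula stays
-- true along every partial isomorphism that is defined on them.
record Supported (A : Structure) {n} (φ : Formula n) (v : Vec (Carrier A) n) : Set₁ where
  field
    number    : ℕ
    witnesses : Vec (Carrier A) number
    transfer  : ∀ {B _∼_} → IsPartialIso A B _∼_ → ∀ {v′} → (∀ i → lookup v i ∼ lookup v′ i) →
                (∀ i → ∃ (lookup witnesses i ∼_)) → Sat B φ v′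

∀Σ-positive : ∀ {α n} {φ : Formula n} → Is∀Σ α φ → ¬ α ≤ₒ zero
∀Σ-positive (block β<α _ _) α≤0 with () ← ≤ₒ-trans β<α α≤0

Σ₁-supported : ∀ {A γ n φ} {v : Vec (Carrier A) n} →
               γ ≤ₒ fin 1 → IsΣ γ φ → Sat A φ v → Supported A φ v
Σ₁-supported γ≤1 (qf _ q) s = record
  { number = 0 ; witnesses = [] ; transfer = λ iso v∼v′ _ → to (sat-∼ iso v∼v′ q) s }
Σ₁-supported {A} {γ} {n} {⋁ φ} {v} γ≤1 (⋁∃ blocks) (i , s) =
  record { number = number ; witnesses = witnesses ; transfer = λ iso h h′ → i , transfer iso h h′ }
  where
    go : ∀ {ψ} → Is∃Π γ ψ → Sat A ψ v → Supported A ψ v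
    -- Here `δ` denotes 0, and a member of the conjunction would need a level below it.
    go (block δ<γ k (⋀∀ h)) s with s≤s δ≤0 ← ≤ₒ-trans δ<γ γ≤1 = ⊥-elim (∀Σ-positive (h 0) δ≤0)
    go (block δ<γ k {ψ} (qf _ q)) s with to (sat-∃* A k ψ v) s
    ... | w , t = record
      { number    = k
      ; witnesses = w
      ; transfer  = λ {B} {_∼_} iso {v′} v∼v′ h → from (sat-∃* B k ψ v′)
          (tabulate (proj₁ ∘ h) , to (sat-∼ iso (both B _∼_ v′ v∼v′ h) q) t)
      }
      where
      both : ∀ B (_∼_ : Carrier A → Carrier B → Set) v′ → (∀ i → lookup v i ∼ lookup v′ i) →
             (h : ∀ i → ∃ (lookup w i ∼_)) →
             ∀ i → lookup (w ++ v) i ∼ lookup (tabulate (proj₁ ∘ h) ++ v′) i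
      both B _∼_ v′ v∼v′ h i
        rewrite lookup-splitAt k w v i | lookup-splitAt k (tabulate (proj₁ ∘ h)) v′ i
        with splitAt k i
      ... | inj₁ a rewrite lookup∘tabulate (proj₁ ∘ h) a = proj₂ (h a)
      ... | inj₂ b = v∼v′ b
    open Supported (go (blocks i) s)

-- In contrast to `Realises`, the names cover all levels, and every vertex below `y` has one.
record LadderAt (A : Structure) (g : Pattern) (y : Carrier A) : Set where
  field
    name       : Ladder → Carrier A
    name-top   : name top ≡ y
    name-up    : ∀ i j → P A (name (node i j)) (name (up g i j))
    injective  : ∀ {p q} → name p ≡ name q → p ≡ q
    surjective : ∀ {i a} → Below A i y a → ∃[ p ] a ≡ name p
    below      : ∀ p → Below A (depth p) y (name p)

module _ {A : Structure} (F : IsLadderForest A) where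
  open IsLadderForest F
  open Levels A F

  module _ {y} (y-top : P A y (r A)) (rung : ℕ → Bool → Carrier A)
           (rung-below : ∀ i j → Below A (suc i) y (rung i j))
           (rung-distinct : ∀ i → ¬ rung i false ≡ rung i true) where
    private
      onRung : ∀ {i a} → Below A (suc i) y a → ∃[ j ] a ≡ rung i j
      onRung {i} b with narrow y-top (rung-below i false) (rung-below i true) b (rung-distinct i)
      ... | inj₁ e = false , e
      ... | inj₂ e = true , e

      parentOf : ∀ i j → ∃[ k ] P A (rung (suc i) j) (rung i k)
      parentOf i j with w , p , b ← rung-below (suc i) j with k , refl ← onRung b = k , p

      name : Ladder → Carrier A
      name top        = y
      name (node i j) = rung i j

      below : ∀ p → Below A (depth p) y (name p)
      below top        = refl
      below (node i j) = rung-below i j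

      rung-injective : ∀ {i j k} → rung i j ≡ rung i k → j ≡ k
      rung-injective {j = false} {false} _ = refl
      rung-injective {j = false} {true}  e = ⊥-elim (rung-distinct _ e)
      rung-injective {j = true}  {false} e = ⊥-elim (rung-distinct _ (sym e))
      rung-injective {j = true}  {true}  _ = refl

    -- By `narrow` the two given vertices are the whole level, so the parents of a rung lie on the
    -- rung above and can be read off as `g`. Uniqueness of parents leaves no other choice of `g`.
    rungs⇒ladder : ∃[ g ] LadderAt A g y ×
                   (∀ i (x : Rung) → (∀ j → P A (rung (suc i) j) (rung i (x ! j))) → x ≡ g i)
    rungs⇒ladder = g , ladder , λ i x h →
      cong₂ _,_ (rung-injective (unique (h false) (proj₂ (parentOf i false))))
                (rung-injective (unique (h true) (proj₂ (parentOf i true))))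
      where
      g : Pattern
      g i = proj₁ (parentOf i false) , proj₁ (parentOf i true)

      name-up : ∀ i j → P A (name (node i j)) (name (up g i j))
      name-up zero    j with w , p , refl ← rung-below zero j = p
      name-up (suc i) false = proj₂ (parentOf i false)
      name-up (suc i) true  = proj₂ (parentOf i true)

      injective : ∀ {p q} → name p ≡ name q → p ≡ q
      injective {p} {q} e with below-depth (below p) (subst (Below A (depth q) y) (sym e) (below q))
      injective {top}      {top}      e | _    = refl
      injective {node i j} {node _ k} e | refl = cong (node i) (rung-injective e)

      surjective : ∀ {i a} → Below A i y a → ∃[ p ] a ≡ name p
      surjective {zero}  refl = top , refl
      surjective {suc i} b    = let j , e = onRung b in node i j , e

      ladder : LadderAt A g y
      ladder = record
        { name = name ; name-top = refl ; name-up = name-up ; injective = injective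
        ; surjective = surjective ; below = below }

  -- The given names are kept as far as `node n`, and below that the pairs come from `wide`. The
  -- kept names determine the first `n` entries of the new pattern.
  complete : ∀ {n g y} → P A y (r A) → Realises A n g y →
             ∃[ h ] LadderAt A h y × (∀ i → i < n → g i ≡ h i)
  complete {n} {g} {y} y-top R = h , L , λ i lt → determined i (g i) λ j →
      subst₂ (P A) (sym (rung-≤ lt)) (sym (rung-≤ (<⇒≤ lt))) (name-up (suc i) j lt)
    where
    open Realises R
    rung : ℕ → Bool → Carrier A
    rung i j with i ≤? n
    ... | yes _ = name (node i j)
    ... | no  _ = let u , v , _ = wide i y-top in choose u v j
    rung-≤ : ∀ {i j} → i ≤ n → rung i j ≡ name (node i j)
    rung-≤ {i} le with i ≤? n
    ... | yes _ = refl
    ... | no ≰  = ⊥-elim (≰ le)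
    rung-below : ∀ i j → Below A (suc i) y (rung i j)
    rung-below i j with i ≤? n
    ... | yes le = name-below i j le
    rung-below i false | no _ = let _ , _ , _ , b , _ = wide i y-top in b
    rung-below i true  | no _ = let _ , _ , _ , _ , b = wide i y-top in b
    rung-distinct : ∀ i → ¬ rung i false ≡ rung i true
    rung-distinct i with i ≤? n
    ... | yes le = distinct i le
    ... | no _   = let _ , _ , ne , _ = wide i y-top in ne
    completed = rungs⇒ladder y-top rung rung-below rung-distinct
    h = proj₁ completed
    L = proj₁ (proj₂ completed)
    determined = proj₂ (proj₂ completed)

-- Generic ladders

addLadder : Structure → Pattern → Structure
addLadder A c = attach A (mk↣ {A = ⊤} {to = λ _ → 0} λ _ → refl) λ _ → c

module Splice {A : Structure} (F : IsLadderForest A) {h : Pattern} {y : Carrier A}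
              (y-top : P A y (r A)) (L : LadderAt A h y)
              {c : Pattern} {m : ℕ} (h≡c : ∀ i → i < m → h i ≡ c i) where
  open IsLadderForest F
  open Levels A F
  open LadderAt L

  Inside : Carrier A → Set
  Inside a = ∃[ i ] Below A i y a

  -- The ladder at `y` is moved onto the new ladder as far as depth `m`, and all vertices outside it
  -- stay fixed. Its deeper nodes are related to nothing, since there `h` and `c` may differ.
  data _∼_ : Carrier A → Carrier A ⊎ (⊤ × Ladder) → Set where
    old : ∀ {a} → ¬ Inside a → a ∼ inj₁ a
    new : ∀ {a p} → a ≡ name p → depth p ≤ m → a ∼ inj₂ (tt , p)

  private
    inside : ∀ p → Inside (name p)
    inside p = depth p , below p

    root-outside : ¬ Inside (r A)
    root-outside (zero  , refl)        = orphan _ y-top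
    root-outside (suc i , (w , p , _)) = orphan w p

    nameTop-top : P A (name top) (r A)
    nameTop-top = subst (λ a → P A a (r A)) (sym name-top) y-top

    up-agree : ∀ i j → i < m → up h i j ≡ up c i j
    up-agree zero    j _  = refl
    up-agree (suc i) j lt = cong (λ x → node i (x ! j)) (h≡c i (<⇒≤ lt))

    ∼-≡ : ∀ {a a′ b b′} → a ∼ b → a′ ∼ b′ → a ≡ a′ ⇔ b ≡ b′
    ∼-≡ (old _)      (old _)      = mk⇔ (cong inj₁) inj₁-injective
    ∼-≡ (old ¬i)     (new refl _) = mk⇔ (λ { refl → ⊥-elim (¬i (inside _)) }) λ ()
    ∼-≡ (new refl _) (old ¬i)     = mk⇔ (λ { refl → ⊥-elim (¬i (inside _)) }) λ ()
    ∼-≡ (new refl _) (new refl _) =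
      mk⇔ (cong (λ p → inj₂ (tt , p)) ∘ injective) (cong (name ∘ proj₂) ∘ inj₂-injective)

    ∼-P : ∀ {a a′ b b′} → a ∼ b → a′ ∼ b′ → P A a a′ ⇔ P (addLadder A c) b b′
    ∼-P (old _) (old _) = mk⇔ old λ { (old e) → e }
    ∼-P (old ¬i) (new {p = p} refl _) =
      mk⇔ (λ e → ⊥-elim (¬i (suc (depth p) , _ , e , below p))) λ ()
    ∼-P (new {p = top} refl _) (old _) =
      mk⇔ (λ e → subst (λ a → P (addLadder A c) _ (inj₁ a)) (unique nameTop-top e) top)
          λ { top → nameTop-top }
    ∼-P (new {p = node i j} refl _) (old ¬i) =
      mk⇔ (λ e → ⊥-elim (¬i (subst Inside (unique (name-up i j) e) (inside _)))) λ ()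
    ∼-P (new {p = top} refl _) (new {p = q} refl _) =
      mk⇔ (λ e → ⊥-elim (root-outside (subst Inside (unique e nameTop-top) (inside q)))) λ ()
    ∼-P (new {p = node i j} refl lt) (new {p = q} refl _) = mk⇔
      (λ e → node (trans (sym (up-agree i j lt)) (injective (unique (name-up i j) e))))
      λ { (node refl) → subst (λ p → P A (name (node i j)) (name p)) (up-agree i j lt) (name-up i j) }

  isPartialIso : IsPartialIso A (addLadder A c) _∼_
  isPartialIso = record { ∼-root = old root-outside ; ∼-≡ = ∼-≡ ; ∼-P = ∼-P }

-- Finite conditions and forcing

Condition : Set
Condition = ℕ × Pattern

infix 4 _⊑_

-- A condition stands for the first `n` entries of its pattern; the later ones are arbitrary.
_⊑_ : Condition → Condition → Set
(n , g) ⊑ (m , h) = n ≤ m × ∀ i → i < n → g i ≡ h i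

⊑-refl : ∀ {s} → s ⊑ s
⊑-refl = ≤-refl , λ _ _ → refl

⊑-trans : ∀ {s t u} → s ⊑ t → t ⊑ u → s ⊑ u
⊑-trans (le , e) (le′ , e′) = ≤-trans le le′ , λ i lt → trans (e i lt) (e′ i (<-≤-trans lt le))

lengthen : ∀ {n g} m → n ≤ m → (n , g) ⊑ (m , g)
lengthen _ le = le , λ _ _ → refl

override : ℕ → Rung → Pattern → Pattern
override n x g i with i ≟ n
... | yes _ = x
... | no  _ = g i

override-here : ∀ n {x g} → override n x g n ≡ x
override-here n with n ≟ n
... | yes _ = refl
... | no ≢  = ⊥-elim (≢ refl)

⊑-override : ∀ {n x g} → (n , g) ⊑ (suc n , override n x g)
⊑-override {n} {x} {g} = n≤1+n n , agree
  where
  agree : ∀ i → i < n → g i ≡ override n x g i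
  agree i lt with i ≟ n
  ... | yes refl = ⊥-elim (<-irrefl refl lt)
  ... | no _     = refl

realises-restrict : ∀ {A n m g y} → n ≤ m → Realises A m g y → Realises A n g y
realises-restrict le R = record
  { name = name ; name-top = name-top
  ; name-up = λ i j le′ → name-up i j (≤-trans le′ le)
  ; distinct = λ i le′ → distinct i (≤-trans le′ le) }
  where open Realises R

realises-⊑ : ∀ {A n g m h y} → (n , g) ⊑ (m , h) → Realises A m h y → Realises A n g y
realises-⊑ (le , e) R = realises-cong (λ i lt → sym (e i lt)) (realises-restrict le R)

module Forcing (lem : ∀ (P : Set) → Dec P) {A : Structure} (F : IsLadderForest A) where
  open IsLadderForest F
  open Levels A F

  Avoids : Condition → Carrier A → Set
  Avoids (n , g) x = ¬ Realises A n g x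

  -- Lower nodes false and true have a common parent under rung (false , false) and different
  -- parents under rung (false , true), whatever the order in which the nodes are listed.
  incompatible : ∀ {n g h x} → P A x (r A) → g n ≡ (false , false) → h n ≡ (false , true) →
                 Realises A (suc n) g x → ¬ Realises A (suc n) h x
  incompatible {n} {g} {h} x-top gn hn R S =
    S.distinct n (n≤1+n n) (trans (sameParent false) (sym (sameParent true)))
    where
    module R = Realises R
    module S = Realises S
    R-up : ∀ j → P A (R.name (node (suc n) j)) (R.name (node n false))
    R-up j with e ← R.name-up (suc n) j ≤-refl rewrite gn with j
    ... | false = e
    ... | true  = e
    S-up : ∀ j → P A (S.name (node (suc n) j)) (S.name (node n j))
    S-up j with e ← S.name-up (suc n) j ≤-refl rewrite hn with j
    ... | false = e
    ... | true  = e
    sameParent : ∀ j → S.name (node n j) ≡ R.name (node n false)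
    sameParent j with narrow x-top (R.name-below (suc n) false ≤-refl)
                        (R.name-below (suc n) true ≤-refl) (S.name-below (suc n) j ≤-refl) (R.distinct (suc n) ≤-refl)
    ... | inj₁ e = unique (S-up j) (subst (λ a → P A a _) (sym e) (R-up false))
    ... | inj₂ e = unique (S-up j) (subst (λ a → P A a _) (sym e) (R-up true))

  -- Two incompatible values for the next entry are tried, and `x` can realise at most one of them.
  avoid : ∀ {n g x} → P A x (r A) → ∃[ h ] (n , g) ⊑ (suc n , h) × Avoids (suc n , h) x
  avoid {n} {g} {x} x-top with lem (Realises A (suc n) (override n (false , false) g) x)
  ... | no ¬R = _ , ⊑-override , ¬R
  ... | yes R = _ , ⊑-override , incompatible x-top (override-here n) (override-here n) R

  -- Any ladder of `A` that imitates the new one must realise the condition, so `a` will lie outside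
  -- it.
  AvoidsBranch : Condition → Carrier A → Set
  AvoidsBranch (n , g) a = ∀ {y i} → P A y (r A) → Realises A n g y → ¬ Below A i y a

  -- At most one ladder contains `a`, so it is enough to avoid its top.
  avoidBranch : ∀ s a → ∃[ t ] s ⊑ t × AvoidsBranch t a
  avoidBranch (n , g) a with lem (∃[ x ] ∃[ i ] P A x (r A) × Below A i x a)
  ... | no ¬e = (n , g) , ⊑-refl , λ y-top _ b → ¬e (_ , _ , y-top , b)
  ... | yes (x , i , x-top , b) with avoid x-top
  ...   | h , le , ¬R = (suc n , h) , le , λ y-top R c →
          ¬R (subst (Realises A (suc n) h) (branch-unique y-top x-top c b) R)

  -- What a parameter has to satisfy in order to be in the range of the partial isomorphism of
  -- `Splice`.
  Settled : Condition → Carrier A ⊎ (⊤ × Ladder) → Set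
  Settled s       (inj₁ a)       = AvoidsBranch s a
  Settled (n , _) (inj₂ (_ , p)) = depth p ≤ n

  settled-⊑ : ∀ {s t} b → s ⊑ t → Settled s b → Settled t b
  settled-⊑ (inj₁ a)       s⊑t av y-top R = av y-top (realises-⊑ s⊑t R)
  settled-⊑ (inj₂ (_ , p)) s⊑t le         = ≤-trans le (proj₁ s⊑t)

  settle : ∀ s b → ∃[ t ] s ⊑ t × Settled t b
  settle s       (inj₁ a)       = avoidBranch s a
  settle (n , g) (inj₂ (_ , p)) = (n ⊔ depth p , g) , lengthen _ (m≤m⊔n n _) , m≤n⊔m n _

  settleAll : ∀ s {k} (v : Vec _ k) → ∃[ t ] s ⊑ t × ∀ i → Settled t (lookup v i)
  settleAll s []      = s , ⊑-refl , λ ()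
  settleAll s (b ∷ v) with settle s b
  ... | t , s⊑t , σ with settleAll t v
  ...   | u , t⊑u , τ = u , ⊑-trans s⊑t t⊑u , λ where
    zero    → settled-⊑ b t⊑u σ
    (suc i) → τ i

  -- Truth is required for all patterns through the condition, generic or not.
  _⊩_ : Condition → (Pattern → Set) → Set
  (n , g) ⊩ Q = ∀ c → (∀ i → i < n → g i ≡ c i) → Q c

  ⊩-⊑ : ∀ {s t Q} → s ⊑ t → s ⊩ Q → t ⊩ Q
  ⊩-⊑ (le , e) f c h = f c λ i lt → trans (e i lt) (h i (<-≤-trans lt le))

  -- Once the parameters are settled, density gives a ladder of `A` that realises the condition, and
  -- `f` sends the new ladder onto it. The formula holds in `A` at the images, and `Splice` carries
  -- its finitely many witnesses over to every `c` that agrees with `h` far enough.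
  force : ∀ s {γ k φ} → γ ≤ₒ fin 1 → IsΣ γ φ → (v : Vec (Carrier A ⊎ (⊤ × Ladder)) k) →
          (∀ f → (∀ a → f (inj₁ a) ≡ a) → Sat A φ (Vec.map f v)) →
          ∃[ t ] s ⊑ t × t ⊩ λ c → Sat (addLadder A c) φ v
  force s {φ = φ} γ≤1 σ v sat with settleAll s v
  ... | (n , g) , s⊑ , settled with dense g n
  ...   | y , y-top , R with complete F y-top R
  ...     | h , L , g≡h = (m , h) , ⊑-trans s⊑ (n≤m , g≡h) , forces
    where
    open LadderAt L
    f : Carrier A ⊎ (⊤ × Ladder) → Carrier A
    f = [ id , name ∘ proj₂ ]′
    open Supported (Σ₁-supported γ≤1 σ (sat f λ _ → refl))

    Fits : ℕ → Carrier A → Set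
    Fits m a = ¬ (∃[ i ] Below A i y a) ⊎ (∃[ p ] a ≡ name p × depth p ≤ m)

    -- The length is raised until it bounds the depths of all witnesses on the imitating ladder.
    fit : ∀ {k} n (w : Vec (Carrier A) k) → ∃[ m ] n ≤ m × ∀ i → Fits m (lookup w i)
    fit n []      = n , ≤-refl , λ ()
    fit n (a ∷ w) with fit n w | lem (∃[ i ] Below A i y a)
    ... | m , n≤m , fits | no ¬b      = m , n≤m , λ where
      zero    → inj₁ ¬b
      (suc i) → fits i
    ... | m , n≤m , fits | yes (_ , b) with p , e ← surjective b =
      m ⊔ depth p , ≤-trans n≤m (m≤m⊔n m _) , λ where
        zero    → inj₂ (p , e , m≤n⊔m m _)
        (suc i) → [ inj₁ , (λ (q , e′ , le) → inj₂ (q , e′ , ≤-trans le (m≤m⊔n m _))) ]′ (fits i)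

    m    = proj₁ (fit n witnesses)
    n≤m  = proj₁ (proj₂ (fit n witnesses))
    fits = proj₂ (proj₂ (fit n witnesses))

    forces : (m , h) ⊩ λ c → Sat (addLadder A c) φ v
    forces c h≡c = transfer isPartialIso
      (λ i → subst (_∼ lookup v i) (sym (lookup-map i f v)) (related (lookup v i) (settled i)))
      (λ i → image (fits i))
      where
      open Splice F y-top L {c} {m} h≡c
      related : ∀ b → Settled (n , g) b → f b ∼ b
      related (inj₁ a)       av = old λ (i , b) → av y-top R b
      related (inj₂ (_ , p)) le = new refl (≤-trans le n≤m)
      image : ∀ {a} → Fits m a → ∃ (a ∼_)
      image (inj₁ ¬b)          = _ , old ¬b
      image (inj₂ (p , e , le)) = _ , new e le

-- Construction of a generic pattern

≅-refl : ∀ {A} → A ≅ A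
≅-refl = record { bijection = ↔-id _ ; r-preserved = refl ; P-preserved = λ _ _ → ⇔.refl }

realises-≅ : ∀ {A B n g y} (iso : A ≅ B) → Realises A n g y → Realises B n g (_≅_.to iso y)
realises-≅ iso R = record
  { name     = I.to ∘ name
  ; name-top = cong I.to name-top
  ; name-up  = λ i j le → to (I.P-preserved _ _) (name-up i j le)
  ; distinct = λ i le e → distinct i le (Injection.injective (↔⇒↣ I.bijection) e)
  }
  where
  module I = _≅_ iso
  open Realises R

-- Excluded middle inverts the injection; numbers that code nothing are sent to `x₀`.
enumerate : (∀ (P : Set) → Dec P) → ∀ {X : Set} → X → X ↣ ℕ → ∃ λ (e : ℕ → X) → ∀ x → ∃[ n ] e n ≡ x
enumerate lem {X} x₀ X↣ℕ = e , λ x → code x , inverse x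
  where
  open Injection X↣ℕ using (injective) renaming (to to code)
  e : ℕ → X
  e n with lem (∃[ x ] code x ≡ n)
  ... | yes (x , _) = x
  ... | no _        = x₀
  inverse : ∀ x → e (code x) ≡ x
  inverse x with lem (∃[ x′ ] code x′ ≡ code x)
  ... | yes (x′ , eq) = injective eq
  ... | no ∄          = ⊥-elim (∄ (x , refl))

-- A common form for the conjuncts of Π formulas of all levels up to 2.
data Is∀Σ₁ {n} : Formula n → Set where
  block : ∀ {γ} → γ ≤ₒ fin 1 → ∀ k {σ} → IsΣ γ σ → Is∀Σ₁ (∀* k σ)

module Generic (lem : ∀ (P : Set) → Dec P) {A : Structure} (F : IsLadderForest A) where
  open Forcing lem F

  private
    Added : Set
    Added = Carrier A ⊎ (⊤ × Ladder)

    enumA : ∃ λ (e : ℕ → Carrier A) → ∀ x → ∃[ n ] e n ≡ x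
    enumA = enumerate lem (r A) (countable A)

    enumB : ∃ λ (e : ℕ → Added) → ∀ x → ∃[ n ] e n ≡ x
    -- Any pattern will do here, as the carrier and its coding do not depend on it.
    enumB = enumerate lem (inj₁ (r A)) (countable (addLadder A λ _ → false , false))

  tuple : ∀ k → ℕ → Vec Added k
  tuple k t = tabulate (decode (proj₁ enumB) t ∘ toℕ)

  module _ {n} (v : Vec (Carrier A) n) where

    -- The universal block is filled with the tuple coded by `t`. The tuples are taken from a
    -- carrier that is known before `c` is.
    Instance : ∀ {χ : Formula n} → Is∀Σ₁ χ → ℕ → Pattern → Set
    Instance (block _ k {σ} _) t c = Sat (addLadder A c) σ (tuple k t ++ Vec.map inj₁ v)

    forceInstance : ∀ {χ} (h : Is∀Σ₁ χ) → Sat A χ v → ∀ t s → ∃[ u ] s ⊑ u × u ⊩ Instance h t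
    forceInstance (block γ≤1 k {σ} isΣ) sat t s =
      force s γ≤1 isΣ (tuple k t ++ Vec.map inj₁ v) λ f f-inj₁ →
        subst (Sat A σ) (sym (restrict f f-inj₁)) (to (sat-∀* A k σ v) sat (Vec.map f (tuple k t)))
      where
      restrict : ∀ f → (∀ a → f (inj₁ a) ≡ a) →
                 Vec.map f (tuple k t ++ Vec.map inj₁ v) ≡ Vec.map f (tuple k t) ++ v
      restrict f f-inj₁ = trans (map-++ f (tuple k t) _)
        (cong (Vec.map f (tuple k t) ++_)
          (trans (sym (map-∘ f inj₁ v)) (trans (map-cong f-inj₁ v) (map-id v))))

    instances⇒sat : ∀ {χ} (h : Is∀Σ₁ χ) c → (∀ t → Instance h t c) →
                    Sat (addLadder A c) χ (Vec.map inj₁ v)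
    instances⇒sat (block _ k {σ} _) c inst = from (sat-∀* (addLadder A c) k σ _) λ w →
      let t , e = decode-vec (proj₁ enumB) (proj₂ enumB) w in
      subst (λ u → Sat (addLadder A c) σ (u ++ Vec.map inj₁ v)) e (inst t)

    -- Along an increasing chain of conditions, stage `q` forces the instance coded by `q` and
    -- avoids the `q`-th vertex of `A` if that is a child of the root.
    generic : {χ : ℕ → Formula n} → (∀ i → Is∀Σ₁ (χ i)) → (∀ i → Sat A (χ i) v) →
              ∃[ c ] ¬ addLadder A c ≅ A × ∀ i → Sat (addLadder A c) (χ i) (Vec.map inj₁ v)
    generic {χ} ∀Σ₁ sat = c , notIso , λ i → instances⇒sat (∀Σ₁ i) c λ t →
        let q , e = unpair-surjective i t in
        subst (λ p → Instance (∀Σ₁ (proj₁ p)) (proj₂ p) c) e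
          (Step.forces (step q (condition q)) c (meets (suc q)))
      where
      record Step (q : ℕ) (s : Condition) : Set where
        field
          result    : Condition
          extends : s ⊑ result
          longer  : proj₁ s < proj₁ result
          forces  : result ⊩ Instance (∀Σ₁ (proj₁ (unpair q))) (proj₂ (unpair q))
          avoids  : P A (proj₁ enumA q) (r A) → Avoids result (proj₁ enumA q)

      step : ∀ q s → Step q s
      step q s with forceInstance (∀Σ₁ (proj₁ (unpair q))) (sat _) (proj₂ (unpair q)) s
      ... | (m , h) , s⊑ , f with lem (P A (proj₁ enumA q) (r A))
      ...   | no ¬p = record
        -- With nothing to avoid, the condition is still lengthened, so that the chain determines
        -- all of `c`.
        { result    = suc m , h
        ; extends = ⊑-trans s⊑ (lengthen _ (n≤1+n m))
        ; longer  = s≤s (proj₁ s⊑)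
        ; forces  = ⊩-⊑ {Q = Instance (∀Σ₁ _) _} (lengthen _ (n≤1+n m)) f
        ; avoids  = λ p → ⊥-elim (¬p p)
        }
      ...   | yes p with avoid {m} {h} p
      ...     | h′ , ⊑h′ , av = record
        { result    = suc m , h′
        ; extends = ⊑-trans s⊑ ⊑h′
        ; longer  = s≤s (proj₁ s⊑)
        ; forces  = ⊩-⊑ {Q = Instance (∀Σ₁ _) _} ⊑h′ f
        ; avoids  = λ _ → av
        }

      condition : ℕ → Condition
      condition zero    = 0 , λ _ → false , false
      condition (suc q) = Step.result (step q (condition q))

      length≥ : ∀ q → q ≤ proj₁ (condition q)
      length≥ zero    = z≤n
      length≥ (suc q) = ≤-trans (s≤s (length≥ q)) (Step.longer (step q (condition q)))

      chain : ∀ q d → condition q ⊑ condition (d + q)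
      chain q zero    = ⊑-refl
      chain q (suc d) = ⊑-trans (chain q d) (Step.extends (step (d + q) (condition (d + q))))

      mono : ∀ {p q} → p ≤ q → condition p ⊑ condition q
      mono {p} {q} le = subst (λ m → condition p ⊑ condition m) (m∸n+n≡m le) (chain p (q ∸ p))

      c : Pattern
      -- This condition has length at least `suc i`, so entry `i` is final.
      c i = proj₂ (condition (suc i)) i

      meets : ∀ q i → i < proj₁ (condition q) → proj₂ (condition q) i ≡ c i
      meets q i lt with ≤-total q (suc i)
      ... | inj₁ le = proj₂ (mono le) i lt
      ... | inj₂ ge = sym (proj₂ (mono ge) i (length≥ (suc i)))

      notIso : ¬ addLadder A c ≅ A
      -- The image of the new top is a child of the root that realises every finite part of `c`, but
      -- it was avoided at its own stage `q`.
      notIso iso with proj₂ enumA (_≅_.to iso (inj₂ (tt , top)))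
      ... | q , e = Step.avoids (step q (condition q))
          (subst₂ (P A) (sym e) r-preserved (to (P-preserved _ _) top))
          (subst (Realises A _ _) (sym e) (realises-cong (λ i lt → sym (meets (suc q) i lt))
            (realises-≅ iso (realises-attached A _ _ tt _))))
        where open _≅_ iso

-- Scott sentences

IsΠ⇒∀Σ₁ : ∀ {β n} {ψ : Formula n} → β ≤ₒ fin 2 → IsΠ β ψ → ∃ λ (χ : ℕ → Formula n) →
          (∀ i → Is∀Σ₁ (χ i)) × (∀ A v → Sat A ψ v ⇔ (∀ i → Sat A (χ i) v))
IsΠ⇒∀Σ₁ {ψ = ψ} _ (qf _ q) =
  (λ _ → ψ) , (λ _ → block (z≤ {fin 1}) 0 (qf z≤ q)) , λ A v → mk⇔ (λ s _ → s) (λ s → s 0)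
IsΠ⇒∀Σ₁ β≤2 (⋀∀ {φ} h) = φ , (λ i → weaken (h i)) , λ A v → ⇔.refl
  where
  weaken : ∀ {φ} → Is∀Σ _ φ → Is∀Σ₁ φ
  weaken (block γ<β k isΣ) with s≤s γ≤1 ← ≤ₒ-trans γ<β β≤2 = block γ≤1 k isΣ

module _ (lem : ∀ (P : Set) → Dec P) {A : Structure} (F : IsLadderForest A) where

  -- The witnesses `w` of a true disjunct are kept as parameters, and the generic extension
  -- preserves every conjunct of the Π formula at `w`.
  noΣ₃ScottSentence : ¬ HasΣScottSentence (fin 3) A
  noΣ₃ScottSentence (⋁ θ , ⋁∃ blocks , scott) with i , s ← from (scott A) ≅-refl =
    refute (blocks i) s λ B t → to (scott B) (i , t)
    where
    refute : ∀ {φ} → Is∃Π (fin 3) φ → A ⊨ φ → ¬ (∀ B → B ⊨ φ → B ≅ A)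
    refute (block β<3 k {ψ} isΠ) s unique with to (sat-∃* A k ψ []) s | β<3
    ... | w , t | s≤s β≤2 with χ , ∀Σ₁ , equiv ← IsΠ⇒∀Σ₁ β≤2 isΠ
      with Generic.generic lem F (w ++ []) ∀Σ₁ (to (equiv A _) t)
    ...   | c , ≇ , sats = ≇ (unique (addLadder A c) (from (sat-∃* (addLadder A c) k ψ [])
            (Vec.map inj₁ w , subst (Sat (addLadder A c) ψ) (map-++ inj₁ w [])
              (from (equiv _ _) sats))))

-- Comparison with the Scott rank

module _ (lem : ∀ (P : Set) → Dec P) where

  -- At a limit, excluded middle decides whether some `f m` reaches `fin (suc n)`; if none does, all
  -- of them are at most `fin n`, and so is their supremum.
  ≤⊎suc≤ : ∀ n α → α ≤ₒ fin n ⊎ fin (suc n) ≤ₒ α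
  ≤⊎suc≤ n       zero    = inj₁ z≤
  ≤⊎suc≤ zero    (suc α) = inj₂ (s≤s z≤)
  ≤⊎suc≤ (suc n) (suc α) = Sum.map s≤s s≤s (≤⊎suc≤ n α)
  ≤⊎suc≤ n       (lim f) with lem (∃[ m ] fin (suc n) ≤ₒ f m)
  ... | yes (m , le) = inj₂ (≤lim m le)
  ... | no ∄         = inj₁ (lim≤ λ m → [ id , (λ le → ⊥-elim (∄ (m , le))) ]′ (≤⊎suc≤ n (f m)))

  -- The sentence becomes a constant disjunction with an empty existential block.
  Π⇒Σ₃ScottSentence : ∀ {α A} → α ≤ₒ fin 1 →
    HasΠScottSentence (suc α) A → HasΣScottSentence (fin 3) A
  Π⇒Σ₃ScottSentence α≤1 (θ , isΠ , scott) =
    ⋁ (λ _ → θ) , ⋁∃ (λ _ → block (s≤s (s≤s α≤1)) 0 isΠ) ,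
    λ B → ⇔.trans (mk⇔ proj₂ (0 ,_)) (scott B)

theorem1p3 : ExcludedMiddle (lsuc 0ℓ) →
    ∃[ φ ] IsΠ (fin 2) {0} φ
    × (∃[ A ] A ⊨ φ)
    × (∀ A → A ⊨ φ → IsTree A)
    × (∀ A → A ⊨ φ → ¬ HasΣScottSentence (fin 3) A)
    × (∀ A → A ⊨ φ → ScottRank≥ (fin 2) A)
theorem1p3 em =
    ladderForest
  , ladderForest-Π₂
  , (model , from (models model) model-isLadderForest)
  , (λ A s → ladderForest⇒tree lem (to (models A) s))
  , noΣ₃
  , λ A s α h → [ (λ α≤1 → ⊥-elim (noΣ₃ A s (Π⇒Σ₃ScottSentence lem α≤1 h))) , id ]′ (≤⊎suc≤ lem 1 α)
  where
  lem : ∀ (P : Set) → Dec P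
  lem P = map′ lower lift em

  models : ∀ A → A ⊨ ladderForest ⇔ IsLadderForest A
  models A = ⇔.trans (sat-ladderForest A) (axioms⇔isLadderForest lem A)

  noΣ₃ : ∀ A → A ⊨ ladderForest → ¬ HasΣScottSentence (fin 3) A
  noΣ₃ A s = noΣ₃ScottSentence lem (to (models A) s)
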